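{- Let $m$ be a positive integer and $G$ a graph such that for all $S\subseteq V(G)$ $$\frac{m+1}{2}\,iso(G\setminus S)+\omega(G\setminus S)\le \frac{1}{m}|S|+1.$$ Then for every vertex $u\in V(G)$, $G$ has an $m$-tree-connected spanning subgraph $H$ such that $d_H(v)\le 2m+1$ for every vertex $v$ and $d_H(u)\le m+1$.
   Context: Graphs are finite, have no loops, but may have multiple edges; degrees count multiplicities. For $S\subseteq V(G)$, $G\setminus S$ is the graph obtained by deleting $S$; $\omega(\cdot)$ is the number of connected components and $iso(\cdot)$ the number of isolated vertices. A graph is $m$-tree-connected if it contains $m$ edge-disjoint spanning trees. -}

module Defs where

open import Data.Fin using (Fin)
open import Data.Fin.Properties using (_≟_)
open import Data.Fin.Subset using (Subset; _∈_; _⊆_; _∩_; ∁; ∣_∣; Empty; Nonempty)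
open import Data.Fin.Subset.Properties using (_∈?_)
open import Data.List using (List; []; _∷_; length; map; filter; allFin; deduplicate)
open import Data.List.Membership.Propositional using () renaming (_∈_ to _∈ˡ_)
open import Data.List.Membership.Propositional.Properties using (∈-filter⁺; ∈-filter⁻; ∈-map⁺; ∈-map⁻; ∈-allFin)
open import Data.List.Relation.Unary.Any using (here; there)
open import Data.List.Relation.Unary.Unique.Propositional using (Unique)
open import Data.Nat as ℕ using (ℕ)
open import Data.Product using (Σ-syntax; ∃; _×_; _,_; proj₁; proj₂)
open import Data.Sum using (_⊎_; inj₁; inj₂; swap)
open import Data.Vec using (tabulate)
open import Data.Vec.Properties using (lookup∘tabulate; lookup⇒[]=; []=⇒lookup)
open import Function using (_∘_)
open import Relation.Binary.PropositionalEquality using (_≡_; _≢_; refl; sym; trans; subst)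
open import Relation.Nullary using (¬_; Dec; yes; does)
open import Relation.Nullary.Decidable using (map′; dec-true; _×-dec_; _⊎-dec_)
open import Relation.Unary using (Pred; Decidable)

-- Finite loopless multigraphs: edges are labelled, so parallel edges are
-- distinct labels with the same ends.  The orientation given by `ends` is
-- never used.
record Graph : Set where
  field
    order    : ℕ
    size     : ℕ
    ends     : Fin size → Fin order × Fin order
    loopless : ∀ e → proj₁ (ends e) ≢ proj₂ (ends e)

  Vertex Edge : Set
  Vertex = Fin order
  Edge   = Fin size

  Joins : Edge → Vertex → Vertex → Set
  Joins e u v = ends e ≡ (u , v) ⊎ ends e ≡ (v , u)

  Incident : Vertex → Edge → Set
  Incident v e = v ≡ proj₁ (ends e) ⊎ v ≡ proj₂ (ends e)

  incident? : ∀ v → Decidable (Incident v)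
  incident? v e = (v ≟ proj₁ (ends e)) ⊎-dec (v ≟ proj₂ (ends e))

open Graph public

module _ {n p} {P : Pred (Fin n) p} where

  subset : Decidable P → Subset n
  subset P? = tabulate (does ∘ P?)

  ∈-subset⁺ : ∀ (P? : Decidable P) {x} → P x → x ∈ subset P?
  ∈-subset⁺ P? {x} px = lookup⇒[]= x _
    (trans (lookup∘tabulate (does ∘ P?) x) (dec-true (P? x) px))

  ∈-subset⁻ : ∀ (P? : Decidable P) {x} → x ∈ subset P? → P x
  ∈-subset⁻ P? {x} x∈ with P? x | trans (sym (lookup∘tabulate (does ∘ P?) x)) ([]=⇒lookup x∈)
  ... | yes px | _ = px

record Subgraph (G : Graph) : Set where
  field
    vertices : Subset (order G)
    edges    : Subset (size G)
    closed   : ∀ {e v} → e ∈ edges → Incident G v e → v ∈ vertices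

open Subgraph public

module _ (G : Graph) (S : Subset (order G)) where

  private
    Survives : Edge G → Set
    Survives e = proj₁ (ends G e) ∈ ∁ S × proj₂ (ends G e) ∈ ∁ S

    survives? : Decidable Survives
    survives? e = (proj₁ (ends G e) ∈? ∁ S) ×-dec (proj₂ (ends G e) ∈? ∁ S)

    ends-survive : ∀ {e v} → e ∈ subset survives? → Incident G v e → v ∈ ∁ S
    ends-survive e∈ (inj₁ refl) = proj₁ (∈-subset⁻ survives? e∈)
    ends-survive e∈ (inj₂ refl) = proj₂ (∈-subset⁻ survives? e∈)

  infixl 6 _∖_

  _∖_ : Subgraph G
  _∖_ = record
    { vertices = ∁ S
    ; edges    = subset survives?
    ; closed   = ends-survive
    }

module _ {G : Graph} where

  degree : Subgraph G → Vertex G → ℕ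
  degree H v = ∣ subset (λ e → (e ∈? edges H) ×-dec incident? G v e) ∣

  iso : Subgraph G → ℕ
  iso H = ∣ subset (λ v → (v ∈? vertices H) ×-dec (degree H v ℕ.≟ 0)) ∣

  data Walk (H : Subgraph G) : Vertex G → Vertex G → Set where
    stop : ∀ {v} → Walk H v v
    step : ∀ {u v w} (e : Edge G) → e ∈ edges H → Joins G e u v →
           Walk H v w → Walk H u w

  module _ {H : Subgraph G} where

    -- The final vertex is omitted, so that a closed walk lists its base
    -- point only once.
    walkVertices : ∀ {u v} → Walk H u v → List (Vertex G)
    walkVertices stop                 = []
    walkVertices (step {u = u} _ _ _ p) = u ∷ walkVertices p

    walkEdges : ∀ {u v} → Walk H u v → List (Edge G)
    walkEdges stop           = []
    walkEdges (step e _ _ p) = e ∷ walkEdges p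

  -- Distinctness of the edges excludes traversing one edge back and forth,
  -- while two parallel edges do form a cycle.
  IsCycle : ∀ {H : Subgraph G} {v} → Walk H v v → Set
  IsCycle p = walkEdges p ≢ [] × Unique (walkVertices p) × Unique (walkEdges p)

  Acyclic : Subgraph G → Set
  Acyclic H = ∀ {v} (p : Walk H v v) → ¬ IsCycle p

  Connected : Subgraph G → Set
  Connected H = Nonempty (vertices H) ×
                (∀ {u v} → u ∈ vertices H → v ∈ vertices H → Walk H u v)

  IsTree : Subgraph G → Set
  IsTree T = Connected T × Acyclic T

  Spanning : Subgraph G → Set
  Spanning H = ∀ v → v ∈ vertices H

  IsSpanningTreeOf : Subgraph G → Subgraph G → Set
  IsSpanningTreeOf H T =
    vertices T ≡ vertices H × edges T ⊆ edges H × IsTree T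

  TreeConnected : ℕ → Subgraph G → Set
  TreeConnected m H = Σ[ T ∈ (Fin m → Subgraph G) ]
    (∀ i → IsSpanningTreeOf H (T i)) ×
    (∀ {i j} → i ≢ j → Empty (edges (T i) ∩ edges (T j)))

-- `Reach es` is recursive in `es`: a shortest connection uses the head edge at
-- most once, in one of its two directions.

module _ {n : ℕ} where

  Reach : List (Fin n × Fin n) → Fin n → Fin n → Set
  Reach []             u v = u ≡ v
  Reach ((a , b) ∷ es) u v =
    Reach es u v ⊎ (Reach es u a × Reach es b v) ⊎ (Reach es u b × Reach es a v)

  reach? : ∀ es u v → Dec (Reach es u v)
  reach? []             u v = u ≟ v
  reach? ((a , b) ∷ es) u v =
    reach? es u v ⊎-dec
    ((reach? es u a ×-dec reach? es b v) ⊎-dec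
     (reach? es u b ×-dec reach? es a v))

  reach-refl : ∀ es {u} → Reach es u u
  reach-refl []       = refl
  reach-refl (_ ∷ es) = inj₁ (reach-refl es)

  reach-trans : ∀ es {u v w} → Reach es u v → Reach es v w → Reach es u w
  reach-trans [] = trans
  reach-trans (_ ∷ es) = go
    where
    infixr 5 _∙_
    _∙_ : ∀ {u v w} → Reach es u v → Reach es v w → Reach es u w
    _∙_ = reach-trans es

    go : ∀ {u v w} → Reach (_ ∷ es) u v → Reach (_ ∷ es) v w → Reach (_ ∷ es) u w
    go (inj₁ p)              (inj₁ q)              = inj₁ (p ∙ q)
    go (inj₁ p)              (inj₂ (inj₁ (q , r))) = inj₂ (inj₁ (p ∙ q , r))
    go (inj₁ p)              (inj₂ (inj₂ (q , r))) = inj₂ (inj₂ (p ∙ q , r))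
    go (inj₂ (inj₁ (p , q))) (inj₁ r)              = inj₂ (inj₁ (p , q ∙ r))
    go (inj₂ (inj₁ (p , _))) (inj₂ (inj₁ (_ , r))) = inj₂ (inj₁ (p , r))
    go (inj₂ (inj₁ (p , _))) (inj₂ (inj₂ (_ , r))) = inj₁ (p ∙ r)
    go (inj₂ (inj₂ (p , q))) (inj₁ r)              = inj₂ (inj₂ (p , q ∙ r))
    go (inj₂ (inj₂ (p , _))) (inj₂ (inj₁ (_ , r))) = inj₁ (p ∙ r)
    go (inj₂ (inj₂ (p , _))) (inj₂ (inj₂ (_ , r))) = inj₂ (inj₂ (p , r))

  reach-edge : ∀ {es a b} → (a , b) ∈ˡ es → Reach es a b × Reach es b a
  reach-edge {_ ∷ es} (here refl) =
    inj₂ (inj₁ (reach-refl es , reach-refl es)) ,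
    inj₂ (inj₂ (reach-refl es , reach-refl es))
  reach-edge (there i) = inj₁ (proj₁ (reach-edge i)) , inj₁ (proj₂ (reach-edge i))

module _ {G : Graph} (H : Subgraph G) where

  walk-++ : ∀ {u v w} → Walk H u v → Walk H v w → Walk H u w
  walk-++ stop           q = q
  walk-++ (step e i j p) q = step e i j (walk-++ p q)

  edgeEnds : List (Vertex G × Vertex G)
  edgeEnds = map (ends G) (filter (_∈? edges H) (allFin (size G)))

  walk⇒reach : ∀ {u v} → Walk H u v → Reach edgeEnds u v
  walk⇒reach stop           = reach-refl edgeEnds
  walk⇒reach (step e i j p) = reach-trans edgeEnds (first j) (walk⇒reach p)
    where
    ends∈ : ends G e ∈ˡ edgeEnds
    ends∈ = ∈-map⁺ (ends G) (∈-filter⁺ (_∈? edges H) (∈-allFin e) i)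

    first : ∀ {a b} → Joins G e a b → Reach edgeEnds a b
    first (inj₁ eq) = proj₁ (reach-edge (subst (_∈ˡ edgeEnds) eq ends∈))
    first (inj₂ eq) = proj₂ (reach-edge (subst (_∈ˡ edgeEnds) eq ends∈))

  reach⇒walk : ∀ {u v} → Reach edgeEnds u v → Walk H u v
  reach⇒walk = go edgeEnds joined
    where
    Joined : Vertex G → Vertex G → Set
    Joined a b = ∃ λ e → e ∈ edges H × Joins G e a b

    joined : ∀ {a b} → (a , b) ∈ˡ edgeEnds → Joined a b
    joined i with ∈-map⁻ (ends G) i
    ... | e , e∈ , eq =
      e , proj₂ (∈-filter⁻ (_∈? edges H) {xs = allFin (size G)} e∈) , inj₁ (sym eq)

    go : ∀ es → (∀ {a b} → (a , b) ∈ˡ es → Joined a b) →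
         ∀ {u v} → Reach es u v → Walk H u v
    go [] _ refl = stop
    go (_ ∷ es) f (inj₁ p) = go es (f ∘ there) p
    go (_ ∷ es) f (inj₂ (inj₁ (p , q))) with f (here refl)
    ... | e , i , j = walk-++ (go es (f ∘ there) p) (step e i j (go es (f ∘ there) q))
    go (_ ∷ es) f (inj₂ (inj₂ (p , q))) with f (here refl)
    ... | e , i , j = walk-++ (go es (f ∘ there) p) (step e i (swap j) (go es (f ∘ there) q))

  walk? : ∀ u v → Dec (Walk H u v)
  walk? u v = map′ reach⇒walk walk⇒reach (reach? edgeEnds u v)

-- `deduplicate` keeps exactly one vertex from each class of the equivalence
-- relation "joined by a walk", that is, one per connected component.
ω : ∀ {G} → Subgraph G → ℕ
ω {G} H = length (deduplicate (walk? H) (filter (_∈? vertices H) (allFin (order G))))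

{-# OPTIONS --safe #-}

-- Write i_B(X) for the number of edges of B inside X.  Call B sparse if
-- i_B(X) ≤ m (|X| - 1) for all nonempty X, and X tight if equality holds;
-- tight sets that meet are closed under union and intersection.
--
-- (1) For S ⊆ V and a partition of V ∖ S with p parts and e crossing edges,
-- the hypothesis gives m p ≤ e + |S| + m.  Enlarge S until no edge crosses:
-- a vertex with a crossing edge is deleted if it shares its part or has more
-- than m crossing edges; once there is no such vertex, the neighbours of a
-- vertex with fewest crossing edges are deleted, and the isolated vertex so
-- created pays for them.
--
-- (2) Let B be a largest sparse set with degrees at most η, where η is m + 1
-- at u and 2m + 1 elsewhere, and suppose |B| < m (n - 1).  Grow a set S of
-- saturated vertices, adding a vertex when no rearrangement of B inside a
-- tight set disjoint from S lowers its degree below η.  Exchanging edges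
-- shows that in the end every edge of G ∖ S missing from B lies in a tight
-- set disjoint from S.  Counting the edges of B against (1), for the
-- partition of V ∖ S into maximal tight sets, is a contradiction.
--
-- (3) A sparse set with m (n - 1) edges splits into m spanning trees: grow a
-- tree from u edge by edge, as in Lovász's proof of Edmonds' theorem on
-- disjoint arborescences, so that its complement stays (m - 1)-sparse.

module Submission where

open import Defs
import Algebra.Properties.Semiring.Sum as SemiringSum
open import Data.Bool using (Bool; true; false; _∧_; _∨_; not; if_then_else_)
open import Data.Bool.Properties using (∧-comm; ∧-assoc; ∧-idem; ∧-identityʳ; ∧-zeroʳ; ∨-identityʳ; ∨-zeroʳ; not-injective; ¬-not) renaming (_≟_ to _≟ᵇ_)
open import Data.Empty using (⊥; ⊥-elim)
open import Data.Fin using (Fin; zero; suc)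
open import Data.Fin.Properties using (_≟_; any?; all?)
import Data.Fin.Subset as Subset
open import Data.Fin.Subset using (Subset; ∣_∣)
open import Data.Fin.Subset.Properties using (_∈?_; anySubset?; x∈p∩q⁻; x∉p⇒x∈∁p; x∈∁p⇒x∉p)
open import Data.List as List using (List; []; _∷_; length; deduplicate; filter; allFin)
import Data.List.Membership.DecPropositional as DecMembership
open import Data.List.Membership.Propositional using () renaming (_∈_ to _∈ˡ_)
open import Data.List.Membership.Propositional.Properties using (∈-filter⁺; ∈-allFin)
open import Data.List.Properties using (length-map)
import Data.List.Relation.Unary.All as All
open import Data.List.Relation.Unary.AllPairs using ([]; _∷_)
open import Data.List.Relation.Unary.Any as Any using (here; there)
import Data.List.Relation.Unary.Any.Properties as Any
open import Data.List.Relation.Unary.Unique.Propositional using (Unique)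
open import Data.Nat using (ℕ; zero; suc; _+_; _*_; _≤_; _<_; z≤n; s≤s; _≤?_; _<?_; NonZero)
open import Data.Nat.Properties using (+-*-semiring; +-assoc; +-cancelʳ-≡; +-cancelʳ-≤; +-comm; +-identityʳ; +-mono-≤; +-monoʳ-≤; +-monoˡ-≤; +-suc; *-cancelˡ-≤; *-comm; *-distribˡ-+; *-identityʳ; *-identityˡ; *-monoʳ-≤; *-zeroʳ; ≤-pred; ≤-refl; ≤-reflexive; ≤-trans; <-irrefl; <⇒≱; ≰⇒>; ≮⇒≥; m≤m+n; m≤n+m; m≤n⇒m≤1+n; m≤n⇒∃[o]m+o≡n; n≤0⇒n≡0) renaming (_≟_ to _≟ℕ_)
open import Data.Nat.Tactic.RingSolver using (solve; solve-∀)
open import Data.Product using (Σ-syntax; ∃; ∃-syntax; _×_; _,_; proj₁; proj₂)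
open import Data.Sum using (_⊎_; inj₁; inj₂; [_,_]; swap)
open import Data.Vec using (tabulate; lookup)
open import Data.Vec.Properties using (lookup∘tabulate; lookup⇒[]=; []=⇒lookup)
open import Function using (_∘_)
open import Relation.Binary.PropositionalEquality using (_≡_; _≢_; _≗_; refl; sym; trans; cong; cong₂; subst; subst₂; ≢-sym; module ≡-Reasoning)
open import Relation.Nullary using (¬_; ¬?; Dec; yes; no; does; contradiction)
open import Relation.Nullary.Decidable using (map′; _×-dec_; _→-dec_; toWitness; dec-true; dec-false; decidable-stable; ¬¬-excluded-middle)

private
  module ℕΣ = SemiringSum +-*-semiring

  variable
    n k : ℕ

-- Subsets of Fin n as Boolean functions

-- Linear arithmetic by certificate: x ≤ y is a combination of the hypotheses,
-- s the slack, and the identity is left to the ring solver.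
≤-from : ∀ {a b x y} s → x ≤ y → a + y + s ≡ b + x → a ≤ b
≤-from {a} {b} {x} {y} s x≤y eq = +-cancelʳ-≤ y a b
  (≤-trans (m≤m+n (a + y) s) (≤-trans (≤-reflexive eq) (+-monoʳ-≤ b x≤y)))

-- The type of *-monoʳ-≤ is not in normal form, and the ring solver would take
-- the bounds in it for constants.
*-scale : ∀ c {x y} → x ≤ y → c * x ≤ c * y
*-scale c = *-monoʳ-≤ c

-- With `toWitness`, this settles statements about membership bits by evaluating all cases; each
-- pointwise `lem` below is proved so.
∀ᵇ : {P : Bool → Set} → (∀ b → Dec (P b)) → Dec (∀ b → P b)
∀ᵇ P? = map′ (λ { (t , f) true → t ; (t , f) false → f }) (λ h → h true , h false)
             (P? true ×-dec P? false)

infix 4 _==_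

⟦_⟧ : Bool → ℕ
⟦ b ⟧ = if b then 1 else 0

_==_ : Fin n → Fin n → Bool
x == y = does (x ≟ y)

opaque

  -- Kept opaque so that sums stay atomic in later goals; the lemmas of this block are the only
  -- access to them.
  sum : (Fin n → ℕ) → ℕ
  sum = ℕΣ.sum

  sum-empty : (f : Fin 0 → ℕ) → sum f ≡ 0
  sum-empty f = refl

  sum-suc : (f : Fin (suc n) → ℕ) → sum f ≡ f zero + sum (f ∘ suc)
  sum-suc f = refl

  sum-cong : {f g : Fin n → ℕ} → f ≗ g → sum f ≡ sum g
  sum-cong = ℕΣ.sum-cong-≗

  sum-+ : (f g : Fin n → ℕ) → sum (λ i → f i + g i) ≡ sum f + sum g
  sum-+ = ℕΣ.∑-distrib-+

  sum-* : (c : ℕ) (f : Fin n → ℕ) → sum (λ i → c * f i) ≡ c * sum f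
  sum-* c f = sym (ℕΣ.*-distribˡ-sum c f)

  sum-swap : (f : Fin n → Fin k → ℕ) →
             sum (λ i → sum (f i)) ≡ sum (λ j → sum (λ i → f i j))
  sum-swap = ℕΣ.∑-comm

  sum-mono : {f g : Fin n → ℕ} → (∀ i → f i ≤ g i) → sum f ≤ sum g
  sum-mono {zero}  h = z≤n
  sum-mono {suc n} h = +-mono-≤ (h zero) (sum-mono (h ∘ suc))

  sum-point : (x : Fin n) (f : Fin n → ℕ) → sum (λ i → ⟦ i == x ⟧ * f i) ≡ f x
  sum-point {suc n} zero f = trans
    (cong (1 * f zero +_) (ℕΣ.sum-replicate-zero n)) (trans (+-identityʳ _) (*-identityˡ _))
  sum-point {suc n} (suc x) f = trans (sum-cong lem) (sum-point x (f ∘ suc))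
    where
    lem : ∀ i → ⟦ suc i == suc x ⟧ * f (suc i) ≡ ⟦ i == x ⟧ * f (suc i)
    lem i with i ≟ x
    ... | yes _ = refl
    ... | no  _ = refl

Sub : ℕ → Set
Sub n = Fin n → Bool

#_ : Sub n → ℕ
# X = sum (⟦_⟧ ∘ X)

infix 8 #_
infixr 7 _∩_
infixr 6 _∪_

==-refl : (x : Fin n) → (x == x) ≡ true
==-refl x = dec-true (x ≟ x) refl

==⇒≡ : {x y : Fin n} → (x == y) ≡ true → x ≡ y
==⇒≡ {x = x} {y} p with x ≟ y
... | yes q = q

==-sym : (x y : Fin n) → (x == y) ≡ (y == x)
==-sym x y with x ≟ y
... | yes refl = sym (==-refl x)
... | no x≢y   = sym (dec-false (y ≟ x) (x≢y ∘ sym))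

_∪_ _∩_ : Sub n → Sub n → Sub n
(X ∪ Y) v = X v ∨ Y v
(X ∩ Y) v = X v ∧ Y v

∁ : Sub n → Sub n
∁ X v = not (X v)

⊤ : Sub n
⊤ _ = true

｛_｝ : Fin n → Sub n
｛ x ｝ v = v == x

_⊆_ : Sub n → Sub n → Set
X ⊆ Y = ∀ v → X v ≡ true → Y v ≡ true

⊆-antisym : {X Y : Sub n} → X ⊆ Y → Y ⊆ X → X ≗ Y
⊆-antisym {X = X} {Y} X⊆Y Y⊆X v with X v in p | Y v in q
... | true  | true  = refl
... | false | false = refl
... | true  | false = trans (sym (X⊆Y v p)) q
... | false | true  = trans (sym p) (Y⊆X v q)

∨⁺ˡ : ∀ {b} c → b ≡ true → (b ∨ c) ≡ true
∨⁺ˡ _ refl = refl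

∨⁺ʳ : ∀ b {c} → c ≡ true → (b ∨ c) ≡ true
∨⁺ʳ true  _ = refl
∨⁺ʳ false p = p

∧⁺ : ∀ {b c} → b ≡ true → c ≡ true → (b ∧ c) ≡ true
∧⁺ refl refl = refl

∧⁻ : ∀ b {c} → (b ∧ c) ≡ true → b ≡ true × c ≡ true
∧⁻ true p = refl , p

∨⁻ : ∀ b {c} → (b ∨ c) ≡ true → b ≡ true ⊎ c ≡ true
∨⁻ true  _ = inj₁ refl
∨⁻ false p = inj₂ p

sum₂-mono : {f g h k : Fin n → ℕ} → (∀ i → f i + g i ≤ h i + k i) →
            sum f + sum g ≤ sum h + sum k
sum₂-mono {f = f} {g} {h} {k} p = subst₂ _≤_ (sum-+ f g) (sum-+ h k) (sum-mono p)

sum-+-point : {f g : Fin n → ℕ} (x : Fin n) (c : ℕ) →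
              (∀ i → f i ≡ g i + ⟦ i == x ⟧ * c) → sum f ≡ sum g + c
sum-+-point {f = f} {g} x c h = trans (sum-cong h)
  (trans (sum-+ g _) (cong (sum g +_) (sum-point x (λ _ → c))))

#-cong : {X Y : Sub n} → X ≗ Y → # X ≡ # Y
#-cong h = sum-cong (cong ⟦_⟧ ∘ h)

⟦⟧-mono : ∀ {b c} → (b ≡ true → c ≡ true) → ⟦ b ⟧ ≤ ⟦ c ⟧
⟦⟧-mono {false} h = z≤n
⟦⟧-mono {true} h rewrite h refl = ≤-refl

#-mono : {X Y : Sub n} → X ⊆ Y → # X ≤ # Y
#-mono h = sum-mono (λ v → ⟦⟧-mono (h v))

#-point : (x : Fin n) → # ｛ x ｝ ≡ 1
#-point x = trans (sum-cong (λ i → sym (*-identityʳ _))) (sum-point x (λ _ → 1))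

#-pos : {X : Sub n} (x : Fin n) → X x ≡ true → 1 ≤ # X
#-pos {X = X} x Xx = subst (_≤ # X) (#-point x) (#-mono lem)
  where
  lem : ｛ x ｝ ⊆ X
  lem v p with v ≟ x
  ... | yes refl = Xx

#-witness : (X : Sub n) → 1 ≤ # X → ∃[ x ] X x ≡ true
#-witness {zero} X p = contradiction (subst (1 ≤_) (sum-empty _) p) λ ()
#-witness {suc n} X p with X zero in eq
... | true  = zero , eq
... | false with #-witness (X ∘ suc) (subst (1 ≤_) (trans (sum-suc _) (cong (λ b → ⟦ b ⟧ + sum (⟦_⟧ ∘ X ∘ suc)) eq)) p)
...   | x , q = suc x , q

_+ₑ_ _-ₑ_ : Sub n → Fin n → Sub n
B +ₑ e = B ∪ ｛ e ｝
B -ₑ e = B ∩ ∁ ｛ e ｝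

-- Counting within `Q` serves degrees (`Q = inc v`) and edges inside a vertex set (`Q = inside X`)
-- alike.
module _ (B : Sub n) {e : Fin n} (Q : Sub n) where

  #-insert : B e ≡ false → # ((B +ₑ e) ∩ Q) ≡ # (B ∩ Q) + ⟦ Q e ⟧
  #-insert Be = sum-+-point e ⟦ Q e ⟧ pt
    where
    pt : ∀ i → ⟦ ((B +ₑ e) ∩ Q) i ⟧ ≡ ⟦ (B ∩ Q) i ⟧ + ⟦ i == e ⟧ * ⟦ Q e ⟧
    pt i with i ≟ e
    ... | yes refl rewrite Be = sym (+-identityʳ _)
    ... | no _ with B i | Q i
    ...   | true  | true = refl
    ...   | true  | false = refl
    ...   | false | _ = refl

  #-delete : B e ≡ true → # (B ∩ Q) ≡ # ((B -ₑ e) ∩ Q) + ⟦ Q e ⟧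
  #-delete Be = sum-+-point e ⟦ Q e ⟧ pt
    where
    pt : ∀ i → ⟦ (B ∩ Q) i ⟧ ≡ ⟦ ((B -ₑ e) ∩ Q) i ⟧ + ⟦ i == e ⟧ * ⟦ Q e ⟧
    pt i with i ≟ e
    ... | yes refl rewrite Be = sym (+-identityʳ _)
    ... | no _ with B i | Q i
    ...   | true  | true = refl
    ...   | true  | false = refl
    ...   | false | _ = refl

#-∪∩ : (X Y : Sub n) → # X + # Y ≡ # (X ∪ Y) + # (X ∩ Y)
#-∪∩ X Y = trans (sym (sum-+ (⟦_⟧ ∘ X) _)) (trans (sum-cong lem) (sum-+ (⟦_⟧ ∘ (X ∪ Y)) _))
  where
  lem : ∀ i → ⟦ X i ⟧ + ⟦ Y i ⟧ ≡ ⟦ X i ∨ Y i ⟧ + ⟦ X i ∧ Y i ⟧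
  lem i with X i | Y i
  ... | true  | true = refl
  ... | true  | false = refl
  ... | false | true = refl
  ... | false | false = refl

#-add : (X : Sub n) {x : Fin n} → X x ≡ false → # (X +ₑ x) ≡ # X + 1
#-add X {x} Xx = trans (#-cong λ v → sym (∧-identityʳ ((X +ₑ x) v)))
  (trans (#-insert X ⊤ Xx) (cong (_+ 1) (#-cong λ v → ∧-identityʳ (X v))))

#-⊆-≥ : {X Y : Sub n} → X ⊆ Y → # Y ≤ # X → Y ⊆ X
#-⊆-≥ {X = X} {Y} X⊆Y le v Yv with X v in Xv
... | true = refl
... | false = contradiction le (<⇒≱ (≤-trans (≤-reflexive (trans (+-comm 1 _) (sym (#-add X Xv)))) (#-mono lem)))
  where
  lem : (X +ₑ v) ⊆ Y
  lem i p with ∨⁻ (X i) p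
  ... | inj₁ q = X⊆Y i q
  ... | inj₂ q = subst (λ w → Y w ≡ true) (sym (==⇒≡ q)) Yv

-- `resp` bridges the passage through vectors, from which a Boolean function comes back only
-- pointwise equal.
anySub? : {P : Sub n → Set} → (∀ {X Y} → X ≗ Y → P X → P Y) → (∀ X → Dec (P X)) → Dec (∃ P)
anySub? resp P? = map′ (λ (v , p) → lookup v , p)
  (λ (X , p) → tabulate X , resp (λ i → sym (lookup∘tabulate X i)) p)
  (anySubset? (P? ∘ lookup))

#-split : (X R : Sub n) → # X ≡ # (R ∩ X) + # (∁ R ∩ X)
#-split X R = trans (sum-cong λ v → lem (X v) (R v)) (sum-+ (⟦_⟧ ∘ (R ∩ X)) (⟦_⟧ ∘ (∁ R ∩ X)))
  where
  lem : ∀ p q → ⟦ p ⟧ ≡ ⟦ q ∧ p ⟧ + ⟦ not q ∧ p ⟧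
  lem = toWitness {a? = ∀ᵇ λ _ → ∀ᵇ λ _ → _ ≟ℕ _} _

#-strict : {X Y : Sub n} → X ⊆ Y → ∀ x → Y x ≡ true → X x ≡ false → # X < # Y
#-strict {X = X} {Y} X⊆Y x Yx Xx = ≰⇒> λ le → contradiction (trans (sym Xx) (#-⊆-≥ X⊆Y le x Yx)) λ ()

#-remove : {X : Sub n} (x : Fin n) → X x ≡ true → # X ≡ # (X -ₑ x) + 1
#-remove {X = X} x Xx = trans (#-cong (λ v → sym (∧-identityʳ (X v))))
  (trans (#-delete X ⊤ Xx) (cong (_+ 1) (#-cong (λ v → ∧-identityʳ ((X -ₑ x) v)))))

#-∅ : #_ {n} (λ _ → false) ≡ 0
#-∅ = sum-* 0 (λ _ → 0)

-- Sparse and tight edge sets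

module Sparsity (G : Graph) where

  private
    a b : Edge G → Vertex G
    a = proj₁ ∘ ends G
    b = proj₂ ∘ ends G

  𝕍 : Sub (order G)
  𝕍 = ⊤

  inside : Sub (order G) → Sub (size G)
  inside X e = X (a e) ∧ X (b e)

  i : Sub (size G) → Sub (order G) → ℕ
  i B X = # (B ∩ inside X)

  i-cong : ∀ B {X Y} → X ≗ Y → i B X ≡ i B Y
  i-cong B h = #-cong (λ e → cong₂ (λ p q → B e ∧ p ∧ q) (h (a e)) (h (b e)))

  i-mono : ∀ {B C X Y} → B ⊆ C → X ⊆ Y → i B X ≤ i C Y
  i-mono {B} {C} {X} {Y} B⊆C X⊆Y = #-mono lem
    where
    lem : (B ∩ inside X) ⊆ (C ∩ inside Y)
    lem e p with Be , q ← ∧⁻ (B e) p with Xa , Xb ← ∧⁻ (X (a e)) q =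
      ∧⁺ (B⊆C e Be) (∧⁺ (X⊆Y _ Xa) (X⊆Y _ Xb))

  Sparse : ℕ → Sub (size G) → Set
  Sparse m B = ∀ X x → X x ≡ true → i B X + m ≤ m * # X

  -- Only the converse of the inequality in `Sparse`, hence equality for nonempty `X` and sparse
  -- `B`. The empty set qualifies trivially.
  Tight : ℕ → Sub (size G) → Sub (order G) → Set
  Tight m B X = m * # X ≤ i B X + m

  splice : Sub (order G) → (D C : Sub (size G)) → Sub (size G)
  splice X D C e = if inside X e then D e else C e

  -- Edge by edge: inside `X`, an edge of `D` counted in `Y` lies inside `X ∩ Y`, and an edge of `C`
  -- lies inside `X ∪ Y`. An edge of `C` that is inside `Y` but not inside `X` also lies inside
  -- `X ∪ Y`.
  i-splice : ∀ X Y D C → i (splice X D C) Y + i C X ≤ i D (X ∩ Y) + i C (X ∪ Y)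
  i-splice X Y D C = sum₂-mono λ e → lem (D e) (C e) (X (a e)) (X (b e)) (Y (a e)) (Y (b e))
    where
    lem : ∀ d c p q r s → ⟦ (if p ∧ q then d else c) ∧ r ∧ s ⟧ + ⟦ c ∧ p ∧ q ⟧ ≤
                          ⟦ d ∧ (p ∧ r) ∧ (q ∧ s) ⟧ + ⟦ c ∧ (p ∨ r) ∧ (q ∨ s) ⟧
    lem = toWitness {a? = ∀ᵇ λ _ → ∀ᵇ λ _ → ∀ᵇ λ _ → ∀ᵇ λ _ → ∀ᵇ λ _ → ∀ᵇ λ _ → _ ≤? _} _

  -- The only gain on the right comes from edges between the part of `X` outside `Y` and the part of
  -- `Y` outside `X`.
  supermodular : ∀ B X Y → i B X + i B Y ≤ i B (X ∩ Y) + i B (X ∪ Y)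
  supermodular B X Y = sum₂-mono λ e → lem (B e) (X (a e)) (X (b e)) (Y (a e)) (Y (b e))
    where
    lem : ∀ d p q r s → ⟦ d ∧ p ∧ q ⟧ + ⟦ d ∧ r ∧ s ⟧ ≤
                        ⟦ d ∧ (p ∧ r) ∧ (q ∧ s) ⟧ + ⟦ d ∧ (p ∨ r) ∧ (q ∨ s) ⟧
    lem = toWitness {a? = ∀ᵇ λ _ → ∀ᵇ λ _ → ∀ᵇ λ _ → ∀ᵇ λ _ → ∀ᵇ λ _ → _ ≤? _} _

  private
    modular : ∀ m (X Y : Sub (order G)) → m * (# (X ∪ Y) + # (X ∩ Y)) ≤ m * (# X + # Y)
    modular m X Y = ≤-reflexive (cong (m *_) (sym (#-∪∩ X Y)))

    -- If two sets attain their bound and one of their union and intersection (weight `d`, size `a`)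
    -- respects it, supermodularity forces the other (weight `u`, size `b`) to attain it. The offset
    -- `k` equals the multiplier for tight sets and is one less for critical sets.
    uncross : ∀ m k c p u d x y b a → p + c ≤ d + u → m * (b + a) ≤ m * (x + y) →
              d + k ≤ m * a → m * x ≤ p + k → m * y ≤ c + k → m * b ≤ u + k
    uncross m k c p u d x y b a h₁ h₂ h₃ h₄ h₅ =
      ≤-from 0 (+-mono-≤ h₁ (+-mono-≤ h₂ (+-mono-≤ h₃ (+-mono-≤ h₄ h₅))))
        (solve (m ∷ k ∷ c ∷ p ∷ u ∷ d ∷ x ∷ y ∷ b ∷ a ∷ []))

  module _ (m : ℕ) where

    sparse-⊆ : ∀ {B C} → C ⊆ B → Sparse m B → Sparse m C
    sparse-⊆ {B} {C} C⊆B sp X x Xx =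
      ≤-trans (+-monoˡ-≤ m (i-mono {C} {B} {X} {X} C⊆B (λ _ p → p))) (sp X x Xx)

    tight-point : ∀ B x → Tight m B ｛ x ｝
    tight-point B x = ≤-trans (≤-reflexive (trans (cong (m *_) (#-point x)) (*-identityʳ m)))
                              (m≤n+m m _)

    private
      arith : ∀ c p u d x y b a → p + c ≤ d + u → m * (b + a) ≤ m * (x + y) →
              d + m ≤ m * a → m * x ≤ c + m → u + m ≤ m * b → p + m ≤ m * y
      arith c p u d x y b a h₁ h₂ h₃ h₄ h₅ =
        ≤-from 0 (+-mono-≤ h₁ (+-mono-≤ h₂ (+-mono-≤ h₃ (+-mono-≤ h₄ h₅))))
          (solve (m ∷ c ∷ p ∷ u ∷ d ∷ x ∷ y ∷ b ∷ a ∷ []))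

    module _ (B : Sub (size G)) {X Y : Sub (order G)} (sp : Sparse m B) (tX : Tight m B X) (tY : Tight m B Y)
             (z : Vertex G) (Xz : X z ≡ true) (Yz : Y z ≡ true) where

      tight-∪ : Tight m B (X ∪ Y)
      tight-∪ = uncross m m (i B Y) (i B X) (i B (X ∪ Y)) (i B (X ∩ Y)) (# X) (# Y) (# (X ∪ Y)) (# (X ∩ Y))
        (supermodular B X Y) (modular m X Y) (sp (X ∩ Y) z (∧⁺ Xz Yz)) tX tY

      tight-∩ : Tight m B (X ∩ Y)
      tight-∩ = uncross m m (i B Y) (i B X) (i B (X ∩ Y)) (i B (X ∪ Y)) (# X) (# Y) (# (X ∩ Y)) (# (X ∪ Y))
        (subst (i B X + i B Y ≤_) (+-comm (i B (X ∩ Y)) _) (supermodular B X Y))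
        (≤-trans (≤-reflexive (cong (m *_) (+-comm (# (X ∩ Y)) _))) (modular m X Y))
        (sp (X ∪ Y) z (∨⁺ˡ (Y z) Xz)) tX tY

    -- For `Y` meeting `X`, `i-splice` bounds the edges inside `Y` by m (|X ∩ Y| - 1) + m (|X ∪ Y| -
    -- 1) - m (|X| - 1), where tightness of `X` supplies the last term. By modularity this is m (|Y|
    -- - 1).
    sparse-splice : ∀ {X D C} → Sparse m D → Sparse m C → Tight m C X → Sparse m (splice X D C)
    sparse-splice {X} {D} {C} spD spC tC Y y Yy with 1 ≤? # (X ∩ Y)
    ... | no ¬p = ≤-trans (+-monoˡ-≤ m (#-mono lem)) (spC Y y Yy)
      where
      lem : (splice X D C ∩ inside Y) ⊆ (C ∩ inside Y)
      lem e p with X (a e) in Xa | X (b e)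
      ... | false | _     = p
      ... | true  | false = p
      ... | true  | true  = contradiction (#-pos {X = X ∩ Y} (a e) (∧⁺ Xa (proj₁ (∧⁻ (Y (a e)) (proj₂ (∧⁻ (D e) p)))))) ¬p
    ... | yes p with #-witness (X ∩ Y) p
    ...   | z , XYz = arith (i C X) (i (splice X D C) Y) (i C (X ∪ Y)) (i D (X ∩ Y))
              (# X) (# Y) (# (X ∪ Y)) (# (X ∩ Y)) (i-splice X Y D C) (modular m X Y)
              (spD (X ∩ Y) z XYz) tC (spC (X ∪ Y) z (∨⁺ˡ (Y z) (proj₁ (∧⁻ (X z) XYz))))

  -- Packing spanning trees into a sparse edge set

  asSubgraph : Sub (size G) → Subgraph G
  asSubgraph F = record
    { vertices = tabulate 𝕍
    ; edges    = tabulate F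
    ; closed   = λ {_} {v} _ _ → lookup⇒[]= v _ (lookup∘tabulate 𝕍 v)
    }

  ∈-edges : ∀ {F e} → F e ≡ true → e Subset.∈ edges (asSubgraph F)
  ∈-edges {F} {e} Fe = lookup⇒[]= e _ (trans (lookup∘tabulate F e) Fe)

  ∈-edges⁻ : ∀ {F e} → e Subset.∈ edges (asSubgraph F) → F e ≡ true
  ∈-edges⁻ {F} {e} e∈ = trans (sym (lookup∘tabulate F e)) ([]=⇒lookup e∈)

  walk-mono : ∀ {F F′ u v} → F ⊆ F′ → Walk (asSubgraph F) u v → Walk (asSubgraph F′) u v
  walk-mono F⊆F′ stop = stop
  walk-mono F⊆F′ (step e e∈ j p) =
    step e (∈-edges (F⊆F′ e (∈-edges⁻ e∈))) j (walk-mono F⊆F′ p)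

  -- R is the vertex set of a partial spanning tree, D the set of edges not used by it.
  module Growing (k : ℕ) (D : Sub (size G)) (R : Sub (order G))
    (sparse : Sparse (suc k) D)
    (bound : ∀ X x → X x ≡ true → i D X + # (R ∩ X) + k ≤ suc k * # X) where

    -- The sets attaining `bound`, an inequality that follows from `Sparse (suc k) D` when `R` is a
    -- single vertex and turns into `Sparse k D` when `R` is everything.
    Critical : Sub (order G) → Set
    Critical X = suc k * # X ≤ i D X + # (R ∩ X) + k

    critical? : ∀ X → Dec (Critical X)
    critical? X = _ ≤? _

    critical-cong : ∀ {X Y} → X ≗ Y → Critical X → Critical Y
    critical-cong {X} {Y} h = subst₂ _≤_ (cong (suc k *_) (#-cong h))
      (cong (_+ k) (cong₂ _+_ (i-cong D h) (#-cong (λ v → cong (R v ∧_) (h v)))))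

    -- The weight `i D X + # (R ∩ X)` is supermodular, its second term being modular, so critical
    -- sets uncross as tight sets do.
    critical-∩ : ∀ {X Y} z → X z ≡ true → Y z ≡ true → Critical X → Critical Y → Critical (X ∩ Y)
    critical-∩ {X} {Y} z Xz Yz cX cY =
      uncross (suc k) k (w Y) (w X) (w (X ∩ Y)) (w (X ∪ Y)) (# X) (# Y) (# (X ∩ Y)) (# (X ∪ Y))
        (rearrange (i D X) (i D Y) (i D (X ∩ Y)) (i D (X ∪ Y)) (# (R ∩ X)) (# (R ∩ Y)) _ _
          (supermodular D X Y) mod)
        (≤-trans (≤-reflexive (cong (suc k *_) (+-comm (# (X ∩ Y)) _))) (modular (suc k) X Y))
        (bound (X ∪ Y) z (∨⁺ˡ (Y z) Xz)) cX cY
      where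
      w : Sub (order G) → ℕ
      w X = i D X + # (R ∩ X)
      rearrange : ∀ x y c d x′ y′ c′ d′ → x + y ≤ c + d → x′ + y′ ≤ d′ + c′ →
                  (x + x′) + (y + y′) ≤ (d + d′) + (c + c′)
      rearrange x y c d x′ y′ c′ d′ p q = ≤-from 0 (+-mono-≤ p q)
        (solve (x ∷ y ∷ c ∷ d ∷ x′ ∷ y′ ∷ c′ ∷ d′ ∷ []))
      mod : # (R ∩ X) + # (R ∩ Y) ≤ # (R ∩ (X ∪ Y)) + # (R ∩ (X ∩ Y))
      mod = sum₂-mono λ v → lem (X v) (Y v) (R v)
        where
        lem : ∀ p q r → ⟦ r ∧ p ⟧ + ⟦ r ∧ q ⟧ ≤ ⟦ r ∧ (p ∨ q) ⟧ + ⟦ r ∧ (p ∧ q) ⟧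
        lem = toWitness {a? = ∀ᵇ λ _ → ∀ᵇ λ _ → ∀ᵇ λ _ → _ ≤? _} _

    Crosses : Sub (order G) → Edge G → Set
    Crosses X e = (D e ∧ inside X e) ≡ true × R (a e) ≢ R (b e)

    -- If no edge of `D` inside `X` joined `R` to its complement, `i D X` would split between
    -- `R ∩ X` and `∁ R ∩ X`. Then `bound` on the first part and `sparse`, which is stronger on sets
    -- disjoint from `R`, on the second leave too few edges for `X` to be critical. If `R ∩ X` is
    -- empty, sparsity of `X` itself contradicts criticality.
    crossing-edge : ∀ {X} v → X v ≡ true → R v ≡ false → Critical X → ∃ (Crosses X)
    crossing-edge {X} v Xv Rv cX with any? (λ e → ((D e ∧ inside X e) ≟ᵇ true) ×-dec ¬? (R (a e) ≟ᵇ R (b e)))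
    ... | yes p = p
    ... | no none = contradiction split (<⇒≱ (short (1 ≤? # (R ∩ X))))
      where
      split : i D X ≤ i D (R ∩ X) + i D (∁ R ∩ X)
      split = ≤-trans (sum-mono pt) (≤-reflexive (sum-+ (⟦_⟧ ∘ (D ∩ inside (R ∩ X))) _))
        where
        lem : ∀ d p q r s → ((d ∧ p ∧ q) ≡ true → r ≡ s) →
              ⟦ d ∧ p ∧ q ⟧ ≤ ⟦ d ∧ (r ∧ p) ∧ (s ∧ q) ⟧ + ⟦ d ∧ (not r ∧ p) ∧ (not s ∧ q) ⟧
        lem = toWitness {a? = ∀ᵇ λ _ → ∀ᵇ λ _ → ∀ᵇ λ _ → ∀ᵇ λ _ → ∀ᵇ λ _ →
                              ((_ ≟ᵇ _) →-dec (_ ≟ᵇ _)) →-dec (_ ≤? _)} _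
        pt : ∀ e → ⟦ (D ∩ inside X) e ⟧ ≤ ⟦ (D ∩ inside (R ∩ X)) e ⟧ + ⟦ (D ∩ inside (∁ R ∩ X)) e ⟧
        pt e = lem (D e) (X (a e)) (X (b e)) (R (a e)) (R (b e))
          λ p → decidable-stable (_ ≟ᵇ _) λ R≢ → none (e , p , R≢)

      outer : i D (∁ R ∩ X) + suc k ≤ suc k * # (∁ R ∩ X)
      outer = sparse (∁ R ∩ X) v (∧⁺ (cong not Rv) Xv)

      cX′ : suc k * (# (R ∩ X) + # (∁ R ∩ X)) ≤ i D X + # (R ∩ X) + k
      cX′ = subst (λ s → suc k * s ≤ i D X + # (R ∩ X) + k) (#-split X R) cX

      short : Dec (1 ≤ # (R ∩ X)) → i D (R ∩ X) + i D (∁ R ∩ X) < i D X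
      short (yes p) with z , XRz ← #-witness (R ∩ X) p =
        arith (i D X) (i D (R ∩ X)) (i D (∁ R ∩ X)) (# (R ∩ X)) (# (∁ R ∩ X))
          (subst (λ s → i D (R ∩ X) + s + k ≤ suc k * # (R ∩ X))
                 (#-cong λ v → trans (sym (∧-assoc (R v) (R v) (X v))) (cong (_∧ X v) (∧-idem (R v))))
                 (bound (R ∩ X) z XRz))
          outer cX′
        where
        arith : ∀ x y z p q → y + p + k ≤ suc k * p → z + suc k ≤ suc k * q →
                suc k * (p + q) ≤ x + p + k → suc (y + z) ≤ x
        arith x y z p q h₁ h₂ h₃ = ≤-from k (+-mono-≤ h₁ (+-mono-≤ h₂ h₃))
          (solve (x ∷ y ∷ z ∷ p ∷ q ∷ k ∷ []))
      short (no ¬p) = ⊥-elim (arith (i D X) (# (R ∩ X)) (# (∁ R ∩ X)) (n≤0⇒n≡0 (≤-pred (≰⇒> ¬p)))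
          (subst (λ s → i D X + suc k ≤ suc k * s) (#-split X R) (sparse X v Xv)) cX′)
        where
        arith : ∀ x p q → p ≡ 0 → x + suc k ≤ suc k * (p + q) →
                suc k * (p + q) ≤ x + p + k → ⊥
        arith x .0 q refl h₁ h₂ = <-irrefl (refl {x = 0})
          (≤-from 0 (+-mono-≤ h₁ h₂) (solve (x ∷ q ∷ k ∷ [])))

    -- Moving `e` into the tree raises `# (R ∩ Y)` for every `Y` containing `y`. If `Y` also
    -- contains `x`, the loss of `e` from `D` makes up for it; `safe` covers the other sets.
    record Extension : Set where
      field
        {x y} : Vertex G
        e     : Edge G
        joins : Joins G e x y
        D-e   : D e ≡ true
        R-x   : R x ≡ true
        R-y   : R y ≡ false
        safe  : ∀ Y → Y y ≡ true → Y x ≡ false → ¬ Critical Y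

    Separates : (x y : Vertex G) → Sub (order G) → Set
    Separates x y Y = Y y ≡ true × Y x ≡ false × Critical Y

    -- Intersecting X with a critical set that contains y but not x leaves a
    -- smaller critical set, so the search ends.
    extension : ∀ s X v → # X ≤ s → X v ≡ true → R v ≡ false → Critical X → Extension
    separate : ∀ s {e x y X} → Joins G e x y → D e ≡ true → R x ≡ true → R y ≡ false →
               X x ≡ true → X y ≡ true → # X ≤ suc s → Critical X → Extension

    extension zero X v X≤s Xv _ _ = contradiction (≤-trans (#-pos {X = X} v Xv) X≤s) λ ()
    extension (suc s) X v X≤s Xv Rv cX with crossing-edge v Xv Rv cX
    ... | e , DX , R≢ with DX′ , p ← ∧⁻ (D e) DX with Xa , Xb ← ∧⁻ (X (a e)) p
      with R (a e) in Ra | R (b e) in Rb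
    ... | true  | true  = contradiction refl R≢
    ... | false | false = contradiction refl R≢
    ... | true  | false = separate s (inj₁ refl) DX′ Ra Rb Xa Xb X≤s cX
    ... | false | true  = separate s (inj₂ refl) DX′ Rb Ra Xb Xa X≤s cX

    separate s {e} {x} {y} {X} j De Rx Ry Xx Xy X≤s cX with anySub? {P = Separates x y} resp separates?
      where
      resp : ∀ {Y Z} → Y ≗ Z → Separates x y Y → Separates x y Z
      resp h (p , q , c) = trans (sym (h y)) p , trans (sym (h x)) q , critical-cong h c
      separates? : ∀ Y → Dec (Separates x y Y)
      separates? Y = (Y y ≟ᵇ true) ×-dec (Y x ≟ᵇ false) ×-dec critical? Y
    ... | no none = record { e = e ; joins = j ; D-e = De ; R-x = Rx ; R-y = Ry
                           ; safe = λ Y p q c → none (Y , p , q , c) }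
    ... | yes (Y , Yy , Yx , cY) = extension s (X ∩ Y) y
          (≤-pred (≤-trans (#-strict (λ v p → proj₁ (∧⁻ (X v) p)) x Xx (trans (cong (_∧ Y x) Xx) Yx)) X≤s))
          (∧⁺ Xy Yy) Ry (critical-∩ y Xy Yy cX cY)

  -- `critical` keeps `𝕍` critical, so the search for the next edge can start there; each step
  -- trades one edge of `D` for one vertex of `R`. `F-inside` makes the vertex added next a leaf of
  -- the enlarged tree.
  record PartialTree (k : ℕ) (B : Sub (size G)) (r : Vertex G) : Set where
    field
      R        : Sub (order G)
      D F      : Sub (size G)
      D⊆B      : D ⊆ B
      F⊆B      : F ⊆ B
      D∩F      : ∀ e → D e ≡ true → F e ≡ false
      bound    : ∀ X x → X x ≡ true → i D X + # (R ∩ X) + k ≤ suc k * # X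
      critical : suc k * # 𝕍 ≤ i D 𝕍 + # (R ∩ 𝕍) + k
      F-inside : ∀ e → F e ≡ true → inside R e ≡ true
      F-sparse : Sparse 1 F
      walks    : ∀ v → R v ≡ true → Walk (asSubgraph F) r v

  inside-joins : ∀ {e x y} X → Joins G e x y → inside X e ≡ X x ∧ X y
  inside-joins X (inj₁ eq) rewrite eq = refl
  inside-joins {y = y} X (inj₂ eq) rewrite eq = ∧-comm (X y) _

  module _ {k : ℕ} {B : Sub (size G)} {r : Vertex G} (sparse : Sparse (suc k) B) where

    open PartialTree

    start : Tight (suc k) B 𝕍 → PartialTree k B r
    start tight = record
      { R = ｛ r ｝ ; D = B ; F = λ _ → false
      ; D⊆B = λ _ p → p ; F⊆B = λ _ () ; D∩F = λ _ _ → refl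
      ; bound = λ X x Xx → ≤-trans (≤-trans
          (+-monoˡ-≤ k (+-monoʳ-≤ (i B X) (≤-trans (#-mono (λ v p → proj₁ (∧⁻ (v == r) p))) (≤-reflexive (#-point r)))))
          (≤-reflexive (+-assoc (i B X) 1 k))) (sparse X x Xx)
      ; critical = ≤-trans tight (≤-reflexive (trans (sym (+-assoc (i B 𝕍) 1 k))
          (cong (λ s → i B 𝕍 + s + k) (sym (trans (#-cong (λ v → ∧-identityʳ (v == r))) (#-point r))))))
      ; F-inside = λ _ ()
      ; F-sparse = λ X x Xx → subst (λ s → s + 1 ≤ 1 * # X) (sym #-∅)
          (subst (1 ≤_) (sym (*-identityˡ _)) (#-pos {X = X} x Xx))
      ; walks = λ v p → subst (Walk _ r) (sym (==⇒≡ p)) stop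
      }

    ExtensionOf : PartialTree k B r → Set
    ExtensionOf T = Growing.Extension k (D T) (R T) (sparse-⊆ (suc k) (D⊆B T) sparse) (bound T)

    extend : (T : PartialTree k B r) → ExtensionOf T →
             Σ[ T′ ∈ PartialTree k B r ] # (∁ (R T′)) < # (∁ (R T))
    extend T ext = record
      { R = R T +ₑ y ; D = D T -ₑ e ; F = F T +ₑ e
      ; D⊆B = λ f p → D⊆B T f (proj₁ (∧⁻ (D T f) p))
      ; F⊆B = λ f p → F⊆ f (∨⁻ (F T f) p)
      ; D∩F = disjoint
      ; bound = bound′
      ; critical = critical′
      ; F-inside = λ f p → F-inside′ f (∨⁻ (F T f) p)
      ; F-sparse = F-sparse′
      ; walks = λ w p → walks′ w (∨⁻ (R T w) p)
      } , #-strict (λ w p → ∁-mono w p) y (cong not R-y) (cong not (trans (cong (R T y ∨_) (==-refl y)) (∨-zeroʳ (R T y))))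
      where
      open Growing k (D T) (R T) (sparse-⊆ (suc k) (D⊆B T) sparse) (bound T)
      open Extension ext

      x≢y : x ≢ y
      x≢y x≡y with () ← trans (sym R-x) (trans (cong (R T) x≡y) R-y)

      ∁-mono : ∀ w → not (R T w ∨ (w == y)) ≡ true → not (R T w) ≡ true
      ∁-mono w p with R T w
      ... | false = refl

      F⊆ : ∀ f → F T f ≡ true ⊎ (f == e) ≡ true → B f ≡ true
      F⊆ f (inj₁ p) = F⊆B T f p
      F⊆ f (inj₂ p) = subst (λ g → B g ≡ true) (sym (==⇒≡ p)) (D⊆B T e D-e)

      disjoint : ∀ f → (D T -ₑ e) f ≡ true → (F T +ₑ e) f ≡ false
      disjoint f p with f ≟ e | ∧⁻ (D T f) p
      ... | no _ | Df , _ = trans (∨-identityʳ _) (D∩F T f Df)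

      bound′ : ∀ X z → X z ≡ true → i (D T -ₑ e) X + # ((R T +ₑ y) ∩ X) + k ≤ suc k * # X
      bound′ X z Xz = subst (λ s → i (D T -ₑ e) X + s + k ≤ suc k * # X) (sym (#-insert (R T) X R-y))
        (cases (X x) (X y) refl refl
          (trans (#-delete (D T) (inside X) D-e) (cong (λ c → i (D T -ₑ e) X + ⟦ c ⟧) (inside-joins X joins))))
        where
        old : i (D T) X + # (R T ∩ X) + k ≤ suc k * # X
        old = bound T X z Xz

        arith₀ : ∀ {o M} d s → o ≡ d + 0 → o + s + k ≤ M → d + (s + 0) + k ≤ M
        arith₀ {M = M} d s refl h = ≤-from 0 h (solve (d ∷ s ∷ k ∷ M ∷ []))

        arith₁ : ∀ {o M} d s → o ≡ d + 0 → o + s + k < M → d + (s + 1) + k ≤ M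
        arith₁ {M = M} d s refl h = ≤-from 0 h (solve (d ∷ s ∷ k ∷ M ∷ []))

        arith₂ : ∀ {o M} d s → o ≡ d + 1 → o + s + k ≤ M → d + (s + 1) + k ≤ M
        arith₂ {M = M} d s refl h = ≤-from 0 h (solve (d ∷ s ∷ k ∷ M ∷ []))

        cases : ∀ p q → X x ≡ p → X y ≡ q → i (D T) X ≡ i (D T -ₑ e) X + ⟦ p ∧ q ⟧ →
                i (D T -ₑ e) X + (# (R T ∩ X) + ⟦ q ⟧) + k ≤ suc k * # X
        cases true  false _ _ eq = arith₀ (i (D T -ₑ e) X) (# (R T ∩ X)) eq old
        cases false false _ _ eq = arith₀ (i (D T -ₑ e) X) (# (R T ∩ X)) eq old
        cases true  true  _ _ eq = arith₂ (i (D T -ₑ e) X) (# (R T ∩ X)) eq old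
        cases false true Xx Xy eq = arith₁ (i (D T -ₑ e) X) (# (R T ∩ X)) eq (≰⇒> (safe X Xy Xx))

      critical′ : suc k * # 𝕍 ≤ i (D T -ₑ e) 𝕍 + # ((R T +ₑ y) ∩ 𝕍) + k
      critical′ = ≤-trans (critical T) (≤-reflexive (trans
        (cong (λ s → s + # (R T ∩ 𝕍) + k) (#-delete (D T) (inside 𝕍) D-e))
        (trans (cong (_+ k) (+-assoc (i (D T -ₑ e) 𝕍) 1 (# (R T ∩ 𝕍))))
          (cong (λ s → i (D T -ₑ e) 𝕍 + s + k) (trans (+-comm 1 _) (sym (#-insert (R T) 𝕍 R-y)))))))

      F-inside′ : ∀ f → F T f ≡ true ⊎ (f == e) ≡ true → inside (R T +ₑ y) f ≡ true
      F-inside′ f (inj₁ p) with Ra , Rb ← ∧⁻ (R T (a f)) (F-inside T f p) = ∧⁺ (∨⁺ˡ _ Ra) (∨⁺ˡ _ Rb)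
      F-inside′ f (inj₂ p) = trans (cong (inside (R T +ₑ y)) (==⇒≡ p))
        (trans (inside-joins (R T +ₑ y) joins) (∧⁺ (∨⁺ˡ _ R-x) (∨⁺ʳ (R T y) (==-refl y))))

      F-sparse′ : Sparse 1 (F T +ₑ e)
      F-sparse′ X z Xz = cases (X x) (X y) refl refl
        (trans (#-insert (F T) (inside X) (D∩F T e D-e)) (cong (λ c → i (F T) X + ⟦ c ⟧) (inside-joins X joins)))
        where
        old : i (F T) X + 1 ≤ 1 * # X
        old = F-sparse T X z Xz

        -- The edges of the old tree have both ends in `R T`, which omits `y`; so only `e` is lost
        -- when the leaf `y` is removed from `X`.
        shrink : (F T ∩ inside X) ⊆ (F T ∩ inside (X -ₑ y))
        shrink f p with Ff , q ← ∧⁻ (F T f) p with Xa , Xb ← ∧⁻ (X (a f)) q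
          with Ra , Rb ← ∧⁻ (R T (a f)) (F-inside T f Ff) =
          ∧⁺ Ff (∧⁺ (∧⁺ Xa (cong not (dec-false (_ ≟ y) (≢y Ra)))) (∧⁺ Xb (cong not (dec-false (_ ≟ y) (≢y Rb)))))
          where
          ≢y : ∀ {w} → R T w ≡ true → w ≢ y
          ≢y Rw w≡y with () ← trans (sym Rw) (trans (cong (R T) w≡y) R-y)

        arith₀ : ∀ {o M} d → o ≡ d + 0 → d + 1 ≤ M → o + 1 ≤ M
        arith₀ {M = M} d refl h = ≤-from 0 h (solve (d ∷ M ∷ []))

        arith₁ : ∀ {o M} d d′ M′ → o ≡ d + 1 → d ≤ d′ → d′ + 1 ≤ 1 * M′ → M ≡ M′ + 1 → o + 1 ≤ 1 * M
        arith₁ d d′ M′ refl h₁ h₂ refl = ≤-from 0 (+-mono-≤ h₁ h₂) (solve (d ∷ d′ ∷ M′ ∷ []))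

        cases : ∀ p q → X x ≡ p → X y ≡ q → i (F T +ₑ e) X ≡ i (F T) X + ⟦ p ∧ q ⟧ →
                i (F T +ₑ e) X + 1 ≤ 1 * # X
        cases true  false _ _ eq = arith₀ (i (F T) X) eq old
        cases false false _ _ eq = arith₀ (i (F T) X) eq old
        cases false true  _ _ eq = arith₀ (i (F T) X) eq old
        cases true  true Xx Xy eq = arith₁ (i (F T) X) (i (F T) (X -ₑ y)) (# (X -ₑ y)) eq (#-mono shrink)
          (F-sparse T (X -ₑ y) x (∧⁺ Xx (cong not (dec-false (x ≟ y) x≢y)))) (#-remove y Xy)

      walks′ : ∀ w → R T w ≡ true ⊎ (w == y) ≡ true → Walk (asSubgraph (F T +ₑ e)) r w
      walks′ w (inj₁ p) = walk-mono (λ f → ∨⁺ˡ _) (walks T w p)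
      walks′ w (inj₂ p) = subst (Walk _ r) (sym (==⇒≡ p))
        (walk-++ _ (walk-mono (λ f → ∨⁺ˡ _) (walks T x R-x))
                   (step e (∈-edges (∨⁺ʳ (F T e) (==-refl e))) joins stop))

    find : (T : PartialTree k B r) (v : Vertex G) → R T v ≡ false → ExtensionOf T
    find T v Rv = Growing.extension k (D T) (R T) (sparse-⊆ (suc k) (D⊆B T) sparse) (bound T)
      (# 𝕍) 𝕍 v ≤-refl refl Rv (critical T)

    spanning-tree : Tight (suc k) B 𝕍 → Σ[ T ∈ PartialTree k B r ] (∀ v → R T v ≡ true)
    spanning-tree tight = grow (# 𝕍) (start tight) (#-mono λ _ _ → refl)
      where
      grow : ∀ s (T : PartialTree k B r) → # (∁ (R T)) ≤ s → Σ[ T ∈ PartialTree k B r ] (∀ v → R T v ≡ true)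
      grow s T le with any? (λ v → R T v ≟ᵇ false)
      ... | no none = T , λ v → ¬-not (λ p → none (v , p))
      grow zero T le | yes (v , Rv) =
        contradiction (≤-trans (#-pos {X = ∁ (R T)} v (cong not Rv)) le) λ ()
      grow (suc s) T le | yes (v , Rv) with T′ , lt ← extend T (find T v Rv) = grow s T′ (≤-pred (≤-trans lt le))

  -- Acyclicity takes the form `Sparse 1`: every nonempty vertex set has fewer edges inside it than
  -- vertices.
  record SpanningTree (r : Vertex G) (B F : Sub (size G)) : Set where
    field
      ⊆-host  : F ⊆ B
      sparse₁ : Sparse 1 F
      walks   : ∀ v → Walk (asSubgraph F) r v

  -- The Nash-Williams–Tutte theorem, for graphs with exactly as many edges as needed.
  packing : ∀ m B r → Sparse m B → Tight m B 𝕍 →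
            Σ[ T ∈ (Fin m → Sub (size G)) ] (∀ j → SpanningTree r B (T j)) ×
            (∀ {j l} e → T j e ≡ true → T l e ≡ true → j ≡ l)
  packing zero    B r _      _     = (λ ()) , (λ ()) , λ { {()} }
  packing (suc k) B r sparse tight
    with T , all ← spanning-tree {r = r} sparse tight = result (packing k D r D-sparse D-tight)
    where
    open PartialTree T
    R∩ : ∀ X → # (R ∩ X) ≡ # X
    R∩ X = #-cong (λ v → cong (_∧ X v) (all v))

    D-sparse : Sparse k D
    D-sparse X x Xx = arith (i D X) (# X)
      (subst (λ s → i D X + s + k ≤ suc k * # X) (R∩ X) (bound X x Xx))
      where
      arith : ∀ d s → d + s + k ≤ suc k * s → d + k ≤ k * s
      arith d s h = ≤-from 0 h (solve (d ∷ s ∷ k ∷ []))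

    D-tight : Tight k D 𝕍
    D-tight = arith (i D 𝕍) (# 𝕍) (subst (λ s → suc k * # 𝕍 ≤ i D 𝕍 + s + k) (R∩ 𝕍) critical)
      where
      arith : ∀ d s → suc k * s ≤ d + s + k → k * s ≤ d + k
      arith d s h = ≤-from 0 h (solve (d ∷ s ∷ k ∷ []))

    Packing : ℕ → Sub (size G) → Set
    Packing m B = Σ[ T ∈ (Fin m → Sub (size G)) ] (∀ j → SpanningTree r B (T j)) ×
                  (∀ {j l} e → T j e ≡ true → T l e ≡ true → j ≡ l)

    result : Packing k D → Packing (suc k) B
    result (Ts , trees , disj) = Ts′ , trees′ , disj′
      where
      Ts′ : Fin (suc k) → Sub (size G)
      Ts′ zero    = F
      Ts′ (suc j) = Ts j

      trees′ : ∀ j → SpanningTree r B (Ts′ j)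
      trees′ zero    = record { ⊆-host = F⊆B ; sparse₁ = F-sparse ; walks = λ v → walks v (all v) }
      trees′ (suc j) = record
        { ⊆-host = λ e p → D⊆B e (St.⊆-host e p) ; sparse₁ = St.sparse₁ ; walks = St.walks }
        where module St = SpanningTree (trees j)

      F-avoids : ∀ j e → F e ≡ true → Ts j e ≡ true → ⊥
      F-avoids j e p q with () ← trans (sym p) (D∩F e (SpanningTree.⊆-host (trees j) e q))

      disj′ : ∀ {j l} e → Ts′ j e ≡ true → Ts′ l e ≡ true → j ≡ l
      disj′ {zero}  {zero}  e p q = refl
      disj′ {zero}  {suc l} e p q = ⊥-elim (F-avoids l e p q)
      disj′ {suc j} {zero}  e p q = ⊥-elim (F-avoids j e q p)
      disj′ {suc j} {suc l} e p q = cong suc (disj e p q)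

-- From sparse edge sets to trees and tree-connectedness

does⇒ : {A : Set} (A? : Dec A) → does A? ≡ true → A
does⇒ (yes p) _ = p

#≤length : (X : Sub n) (xs : List (Fin n)) → (∀ v → X v ≡ true → v ∈ˡ xs) → # X ≤ length xs
#≤length X [] h = ≤-reflexive (trans (#-cong empty) #-∅)
  where
  empty : ∀ v → X v ≡ false
  empty v with X v in Xv
  ... | false = refl
  ... | true with () ← h v Xv
#≤length X (x ∷ xs) h = ≤-trans bound (s≤s (#≤length (X -ₑ x) xs rest))
  where
  rest : ∀ v → (X -ₑ x) v ≡ true → v ∈ˡ xs
  rest v p with v ≟ x | ∧⁻ (X v) p
  ... | no v≢x | Xv , _ with h v Xv
  ...   | here v≡x = contradiction v≡x v≢x
  ...   | there v∈ = v∈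
  bound : # X ≤ suc (# (X -ₑ x))
  bound with X x in Xx
  ... | true  = ≤-reflexive (trans (#-remove x Xx) (+-comm _ 1))
  ... | false = ≤-trans (#-mono λ v Xv → ∧⁺ Xv (cong not (dec-false (v ≟ x)
                  λ v≡x → contradiction (trans (sym Xv) (trans (cong X v≡x) Xx)) λ ()))) (m≤n⇒m≤1+n ≤-refl)

length≤# : (X : Sub n) {xs : List (Fin n)} → Unique xs → (∀ {v} → v ∈ˡ xs → X v ≡ true) → length xs ≤ # X
length≤# X []           h = z≤n
length≤# X {x ∷ xs} (x∉ ∷ u) h = ≤-trans
  (s≤s (length≤# (X -ₑ x) u λ {v} v∈ → ∧⁺ (h (there v∈)) (cong not (dec-false (v ≟ x) (≢-sym (All.lookup x∉ v∈))))))
  (≤-reflexive (trans (+-comm 1 _) (sym (#-remove x (h (here refl))))))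

module _ {G : Graph} where

  open Sparsity G
  open DecMembership (_≟_ {order G}) using () renaming (_∈?_ to _∈ˡ?_)

  module _ {H : Subgraph G} where

    reverse : ∀ {u v} → Walk H u v → Walk H v u
    reverse stop            = stop
    reverse (step e e∈ j p) = walk-++ H (reverse p) (step e e∈ (swap j) stop)

    length-walk : ∀ {u v} (p : Walk H u v) → length (walkEdges p) ≡ length (walkVertices p)
    length-walk stop           = refl
    length-walk (step _ _ _ p) = cong suc (length-walk p)

    walkEdges⊆ : ∀ {u v} (p : Walk H u v) {e} → e ∈ˡ walkEdges p → e Subset.∈ edges H
    walkEdges⊆ (step _ e∈ _ p) (here refl) = e∈
    walkEdges⊆ (step _ _  _ p) (there i)   = walkEdges⊆ p i

    start-visited : ∀ {u v} (p : Walk H u v) (X : Sub (order G)) →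
      (∀ {w} → w ∈ˡ walkVertices p → X w ≡ true) → X v ≡ true → X u ≡ true
    start-visited stop           X h Xv = Xv
    start-visited (step _ _ _ p) X h Xv = h (here refl)

    walkEdges-inside : ∀ {u v} (p : Walk H u v) (X : Sub (order G)) →
      (∀ {w} → w ∈ˡ walkVertices p → X w ≡ true) → X v ≡ true →
      ∀ {e} → e ∈ˡ walkEdges p → inside X e ≡ true
    walkEdges-inside (step e _ j p) X h Xv (here refl) = trans (inside-joins X j)
      (∧⁺ (h (here refl)) (start-visited p X (h ∘ there) Xv))
    walkEdges-inside (step _ _ _ p) X h Xv (there i) = walkEdges-inside p X (h ∘ there) Xv i

  -- A cycle lists as many edges as vertices. Its edges are distinct and lie inside the set `X` of
  -- its vertices, so there are at least `# X` of them, too many for `Sparse 1`.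
  acyclic : ∀ {F} → Sparse 1 F → Acyclic (asSubgraph F)
  acyclic sparse stop (≢[] , _) = ≢[] refl
  acyclic {F} sparse {v} p@(step _ _ _ _) (_ , _ , unique) = contradiction (sparse X v (visits (here refl)))
    (<⇒≱ (subst₂ _<_ (sym (*-identityˡ _)) (+-comm 1 _)
      (s≤s (≤-trans (#≤length X (walkVertices p) (λ w → does⇒ (w ∈ˡ? walkVertices p)))
        (≤-trans (≤-reflexive (sym (length-walk p))) (length≤# (F ∩ inside X) unique used))))))
    where
    X : Sub (order G)
    X w = does (w ∈ˡ? walkVertices p)
    visits : ∀ {w} → w ∈ˡ walkVertices p → X w ≡ true
    visits = dec-true (_ ∈ˡ? walkVertices p)
    used : ∀ {e} → e ∈ˡ walkEdges p → (F ∩ inside X) e ≡ true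
    used i = ∧⁺ (∈-edges⁻ (walkEdges⊆ p i)) (walkEdges-inside p X visits (visits (here refl)) i)

  isTree : ∀ {r B F} → SpanningTree r B F → IsTree (asSubgraph F)
  isTree {r} T = ((r , lookup⇒[]= r _ (lookup∘tabulate ⊤ r)) , λ _ _ → walk-++ _ (reverse (walks _)) (walks _)) , acyclic sparse₁
    where open SpanningTree T

  treeConnected : ∀ m B r → Sparse m B → Tight m B 𝕍 → TreeConnected m (asSubgraph B)
  treeConnected m B r sparse tight with Ts , trees , disjoint ← packing m B r sparse tight =
    (asSubgraph ∘ Ts) ,
    (λ j → refl , (λ e∈ → ∈-edges (SpanningTree.⊆-host (trees j) _ (∈-edges⁻ e∈))) , isTree (trees j)) ,
    λ i≢j (e , e∈) → let p , q = x∈p∩q⁻ _ _ e∈ in i≢j (disjoint e (∈-edges⁻ p) (∈-edges⁻ q))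

-- Families such as `TightAround` come without a decision procedure, so least members are taken
-- under double negation. This suffices because the conclusions finally drawn are `⊥` or decidable.
¬¬-minimal : {A : Set} (f : A → ℕ) → A → ¬ ¬ (Σ[ x ∈ A ] ∀ y → f x ≤ f y)
¬¬-minimal {A} f x = go (f x) x ≤-refl
  where
  go : ∀ s x → f x ≤ s → ¬ ¬ (Σ[ x ∈ A ] ∀ y → f x ≤ f y)
  go s x le κ = ¬¬-excluded-middle λ
    { (no none)       → κ (x , λ y → ≮⇒≥ λ lt → none (y , lt))
    ; (yes (y , y<x)) → smaller s le y y<x }
    where
    smaller : ∀ s → f x ≤ s → ∀ y → f y < f x → ⊥
    smaller zero    le y lt = contradiction (≤-trans lt le) λ ()
    smaller (suc s) le y lt = go s y (≤-pred (≤-trans lt le)) κ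

¬¬-choice : {A : Fin n → Set} → (∀ j → ¬ ¬ A j) → ¬ ¬ (∀ j → A j)
¬¬-choice {zero}  h κ = κ λ ()
¬¬-choice {suc n} h κ = h zero λ p → ¬¬-choice (h ∘ suc) λ q → κ λ { zero → p ; (suc j) → q j }

-- Rearranging a largest sparse set under degree bounds

module Incidence (G : Graph) where

  private
    a b : Edge G → Vertex G
    a = proj₁ ∘ ends G
    b = proj₂ ∘ ends G

  -- Definitionally `does (incident? G v e)`, so degrees carry over to `degree` without conversion.
  inc : Vertex G → Sub (size G)
  inc v e = (v == a e) ∨ (v == b e)

  deg : Sub (size G) → Vertex G → ℕ
  deg B v = # (B ∩ inc v)

  inc-joins : ∀ {e x y} v → Joins G e x y → inc v e ≡ true → v ≡ x ⊎ v ≡ y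
  inc-joins {e} v (inj₁ refl) p with ∨⁻ (v == a e) p
  ... | inj₁ q = inj₁ (==⇒≡ q)
  ... | inj₂ q = inj₂ (==⇒≡ q)
  inc-joins {e} v (inj₂ refl) p with ∨⁻ (v == a e) p
  ... | inj₁ q = inj₂ (==⇒≡ q)
  ... | inj₂ q = inj₁ (==⇒≡ q)

  inc-inside : ∀ {v f} X → inc v f ≡ true → Sparsity.inside G X f ≡ true → X v ≡ true
  inc-inside {v} {f} X p q with Xa , Xb ← ∧⁻ (X (a f)) q with ∨⁻ (v == a f) p
  ... | inj₁ r = trans (cong X (==⇒≡ r)) Xa
  ... | inj₂ r = trans (cong X (==⇒≡ r)) Xb

  handshake : ∀ (S : Sub (order G)) D →
    sum (λ v → ⟦ S v ⟧ * deg D v) ≡ sum (λ e → ⟦ D e ⟧ * (⟦ S (a e) ⟧ + ⟦ S (b e) ⟧))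
  handshake S D = begin
    sum (λ v → ⟦ S v ⟧ * deg D v)                            ≡⟨ sum-cong (λ v → sym (sum-* ⟦ S v ⟧ (λ e → ⟦ (D ∩ inc v) e ⟧))) ⟩
    sum (λ v → sum (λ e → ⟦ S v ⟧ * ⟦ (D ∩ inc v) e ⟧))      ≡⟨ sum-swap (λ v e → ⟦ S v ⟧ * ⟦ (D ∩ inc v) e ⟧) ⟩
    sum (λ e → sum (λ v → ⟦ S v ⟧ * ⟦ (D ∩ inc v) e ⟧))      ≡⟨ sum-cong (λ e → trans (sum-cong (pt e))
                                                                  (trans (sum-+ (λ v → ⟦ v == a e ⟧ * f e v) (λ v → ⟦ v == b e ⟧ * f e v))
                                                                  (trans (cong₂ _+_ (sum-point (a e) (f e)) (sum-point (b e) (f e)))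
                                                                  (sym (*-distribˡ-+ ⟦ D e ⟧ ⟦ S (a e) ⟧ ⟦ S (b e) ⟧))))) ⟩
    sum (λ e → ⟦ D e ⟧ * (⟦ S (a e) ⟧ + ⟦ S (b e) ⟧))        ∎
    where
    open ≡-Reasoning
    f : Edge G → Vertex G → ℕ
    f e v = ⟦ D e ⟧ * ⟦ S v ⟧
    pt : ∀ e v → ⟦ S v ⟧ * ⟦ (D ∩ inc v) e ⟧ ≡ ⟦ v == a e ⟧ * f e v + ⟦ v == b e ⟧ * f e v
    -- Without loops at most one end of `e` is `v`, so the disjunction in `inc` becomes a sum.
    pt e v = lem (S v) (D e) (v == a e) (v == b e) λ (p , q) → loopless G e (trans (sym (==⇒≡ {x = v} p)) (==⇒≡ q))
      where
      lem : ∀ s d p q → ¬ (p ≡ true × q ≡ true) →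
            ⟦ s ⟧ * ⟦ d ∧ (p ∨ q) ⟧ ≡ ⟦ p ⟧ * (⟦ d ⟧ * ⟦ s ⟧) + ⟦ q ⟧ * (⟦ d ⟧ * ⟦ s ⟧)
      lem = toWitness {a? = ∀ᵇ λ _ → ∀ᵇ λ _ → ∀ᵇ λ _ → ∀ᵇ λ _ →
                            ¬? ((_ ≟ᵇ _) ×-dec (_ ≟ᵇ _)) →-dec (_ ≟ℕ _)} _

module Rearranging (G : Graph) (m : ℕ) (η : Vertex G → ℕ) where

  open Sparsity G
  open Incidence G

  private
    a b : Edge G → Vertex G
    a = proj₁ ∘ ends G
    b = proj₂ ∘ ends G

  record Feasible (B : Sub (size G)) : Set where
    field
      sparse  : Sparse m B
      degrees : ∀ v → deg B v ≤ η v

  open Feasible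

  i-𝕍 : ∀ B → i B 𝕍 ≡ # B
  i-𝕍 B = #-cong (λ e → ∧-identityʳ (B e))

  insert-sparse : ∀ {C e} → Sparse m C → C e ≡ false →
    (∀ X → inside X e ≡ true → ¬ Tight m C X) → Sparse m (C +ₑ e)
  insert-sparse {C} {e} sp Ce loose X z Xz = subst (λ s → s + m ≤ m * # X) (sym (#-insert C (inside X) Ce))
    (cases (inside X e) refl)
    where
    cases : ∀ c → inside X e ≡ c → i C X + ⟦ c ⟧ + m ≤ m * # X
    cases false _  = subst (λ s → s + m ≤ m * # X) (sym (+-identityʳ (i C X))) (sp X z Xz)
    cases true  Xe = subst (λ s → s + m ≤ m * # X) (+-comm 1 (i C X)) (≰⇒> (loose X Xe))

  module Blocking (m≥1 : 1 ≤ m) (B : Sub (size G)) (B-feasible : Feasible B)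
    (maximal : ∀ C → Feasible C → # C ≤ # B) where

    AgreesOff : Sub (order G) → Sub (size G) → Set
    AgreesOff X C = ∀ e → inside X e ≡ false → C e ≡ B e

    -- The edges not inside `X` are common to `B` and `C` and cancel from the totals. Hence `X` is
    -- tight for `C` exactly when it is tight for `B`.
    i-agree : ∀ {X C} → AgreesOff X C → # C ≡ # B → i C X ≡ i B X
    i-agree {X} {C} agree eq = +-cancelʳ-≡ (# (B ∩ ∁ (inside X))) _ _
      (trans (cong (i C X +_) (#-cong off)) (trans (sym (split C)) (trans eq (split B))))
      where
      split : ∀ C → # C ≡ i C X + # (C ∩ ∁ (inside X))
      split C = trans (#-split C (inside X)) (cong₂ _+_ (#-cong λ e → ∧-comm (inside X e) _)
        (#-cong λ e → ∧-comm (not (inside X e)) _))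
      off : ∀ e → (B ∩ ∁ (inside X)) e ≡ (C ∩ ∁ (inside X)) e
      off e with inside X e in Xe
      ... | true  = trans (∧-zeroʳ (B e)) (sym (∧-zeroʳ (C e)))
      ... | false = cong (_∧ true) (sym (agree e Xe))

    -- Tightness of `X` is what allows the rearrangement to be combined with another one through
    -- `sparse-splice`.
    record Desaturable (S : Sub (order G)) (v : Vertex G) : Set where
      field
        {X}      : Sub (order G)
        {C}      : Sub (size G)
        X⊆       : X ⊆ ∁ S
        X-v      : X v ≡ true
        tight    : Tight m B X
        feasible : Feasible C
        same-#   : # C ≡ # B
        agrees   : AgreesOff X C
        deg<     : deg C v < η v

    -- C rearranges B inside two tight sets so that both ends of e become
    -- unsaturated; adding e to C must then be prevented by a tight set.
    record Candidate (S : Sub (order G)) (C : Sub (size G)) (e : Edge G) (x y : Vertex G) : Set where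
      field
        {X Y}    : Sub (order G)
        X⊆       : X ⊆ ∁ S
        Y⊆       : Y ⊆ ∁ S
        X-x      : X x ≡ true
        Y-y      : Y y ≡ true
        tight-X  : Tight m C X
        tight-Y  : Tight m C Y
        feasible : Feasible C
        same-#   : # C ≡ # B
        agrees   : ∀ f → inside X f ≡ false → inside Y f ≡ false → C f ≡ B f
        joins    : Joins G e x y
        C-e      : C e ≡ false
        deg-x    : deg C x < η x
        deg-y    : deg C y < η y

    record TightAround (S : Sub (order G)) (C : Sub (size G)) (x y : Vertex G) : Set where
      field
        {Z}   : Sub (order G)
        Z⊆    : Z ⊆ ∁ S
        Z-x   : Z x ≡ true
        Z-y   : Z y ≡ true
        tight : Tight m C Z

    -- The invariant while `S` grows. For empty `S`, `blocked` follows from maximality of `B`; for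
    -- larger `S`, the blocking set must in addition avoid `S`.
    record Obstruction (S : Sub (order G)) : Set where
      field
        saturated : ∀ v → S v ≡ true → η v ≤ deg B v
        blocked   : ∀ {C e x y} → Candidate S C e x y → ¬ ¬ TightAround S C x y

    ends-in : ∀ {e x y} X → Joins G e x y → inside X e ≡ true → X x ≡ true × X y ≡ true
    ends-in {x = x} X j p = ∧⁻ (X x) (trans (sym (inside-joins X j)) p)

    outside : ∀ {P R} → P ⊆ R → ∀ g → inside R g ≡ false → inside P g ≡ false
    outside {P} P⊆R g p = ¬-not λ q → contradiction (trans (sym p)
      (let Pa , Pb = ∧⁻ (P (a g)) q in ∧⁺ (P⊆R _ Pa) (P⊆R _ Pb))) λ ()

    -- If no tight set contained both ends of `e`, then `C +ₑ e` would be feasible and larger than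
    -- `B`.
    no-obstruction : Obstruction (λ _ → false)
    no-obstruction = record { saturated = λ _ () ; blocked = blocked }
      where
      blocked : ∀ {C e x y} → Candidate (λ _ → false) C e x y → ¬ ¬ TightAround (λ _ → false) C x y
      blocked {C} {e} {x} {y} cand none = contradiction (maximal (C +ₑ e) record
        { sparse  = insert-sparse {C} (sparse feasible) C-e loose
        ; degrees = degrees′ }) (<⇒≱ (≤-reflexive (trans (cong suc (sym same-#)) (sym bigger))))
        where
        open Candidate cand
        loose : ∀ X → inside X e ≡ true → ¬ Tight m C X
        loose Z Ze tight with Zx , Zy ← ends-in Z joins Ze =
          none record { Z⊆ = λ _ _ → refl ; Z-x = Zx ; Z-y = Zy ; tight = tight }
        bigger : # (C +ₑ e) ≡ suc (# C)
        bigger = trans (#-add C C-e) (+-comm _ 1)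
        degrees′ : ∀ v → deg (C +ₑ e) v ≤ η v
        degrees′ v = subst (_≤ η v) (sym (#-insert C (inc v) C-e)) (cases (inc v e) refl)
          where
          cases : ∀ c → inc v e ≡ c → deg C v + ⟦ c ⟧ ≤ η v
          cases false _ = subst (_≤ η v) (+-comm 0 (deg C v)) (degrees feasible v)
          cases true  p with inc-joins v joins p
          ... | inj₁ refl = subst (_≤ η v) (+-comm 1 (deg C v)) deg-x
          ... | inj₂ refl = subst (_≤ η v) (+-comm 1 (deg C v)) deg-y

    -- Otherwise `B` itself, with the tight set `｛ v ｝`, would desaturate `v`.
    ¬desaturable⇒saturated : ∀ {S v} → S v ≡ false → ¬ Desaturable S v → η v ≤ deg B v
    ¬desaturable⇒saturated {S} {v} Sv ¬des = ≮⇒≥ λ lt → ¬des record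
      { X⊆ = λ w p → subst (λ z → not (S z) ≡ true) (sym (==⇒≡ p)) (cong not Sv)
      ; X-v = ==-refl v ; tight = tight-point m B v ; feasible = B-feasible
      ; same-# = refl ; agrees = λ _ _ → refl ; deg< = lt }

    module _ {S : Sub (order G)} {v : Vertex G} where

      weaken⊆ : ∀ {X} → X ⊆ ∁ (S +ₑ v) → X ⊆ ∁ S
      weaken⊆ h w p with S w | h w p
      ... | false | _ = refl

      weaken : ∀ {C e x y} → Candidate (S +ₑ v) C e x y → Candidate S C e x y
      weaken c = record { Candidate c ; X⊆ = weaken⊆ (Candidate.X⊆ c) ; Y⊆ = weaken⊆ (Candidate.Y⊆ c) }

    -- In a minimal tight set Z around e every edge lies on the circuit closed by e,
    -- so e can be exchanged for an edge of Z at v, which desaturates v.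
    module Exchange {S : Sub (order G)} {v : Vertex G} {C : Sub (size G)} {e : Edge G} {x y : Vertex G}
      (cand : Candidate S C e x y) (v≢x : v ≢ x) (v≢y : v ≢ y)
      (around : TightAround S C x y) (Z-v : TightAround.Z around v ≡ true)
      (minimal : ∀ (other : TightAround S C x y) → # (TightAround.Z around) ≤ # (TightAround.Z other)) where

      open TightAround around renaming (Z to Z₀)
      open Candidate cand hiding (feasible)

      C-sparse : Sparse m C
      C-sparse = sparse (Candidate.feasible cand)

      Q : Sub (size G)
      Q = inside Z₀ ∩ inc v
      -- `Z₀ -ₑ v` still contains `x`, so by sparsity it has at most m (|Z₀| - 2) edges inside. The
      -- tight set `Z₀` has at least m more, all of them at `v`.
      exchanged : ∃[ f ] (C ∩ Q) f ≡ true
      exchanged = #-witness (C ∩ Q) (arith (i C Z₀) (i C (Z₀ -ₑ v)) (# (C ∩ Q)) (# Z₀) (# (Z₀ -ₑ v))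
        split (C-sparse (Z₀ -ₑ v) x (∧⁺ Z-x (cong not (dec-false (x ≟ v) (≢-sym v≢x)))))
        tight (#-remove v Z-v) m≥1)
        where
        arith : ∀ z z′ q s s′ → z ≤ z′ + q → z′ + m ≤ m * s′ → m * s ≤ z + m → s ≡ s′ + 1 → 1 ≤ m → 1 ≤ q
        arith z z′ q _ s′ h₁ h₂ h₃ refl h₄ = ≤-from 0 (+-mono-≤ h₁ (+-mono-≤ h₂ (+-mono-≤ h₃ h₄)))
          (solve (z ∷ z′ ∷ q ∷ s′ ∷ m ∷ []))
        split : i C Z₀ ≤ i C (Z₀ -ₑ v) + # (C ∩ Q)
        split = ≤-trans (sum-mono pt) (≤-reflexive (sum-+ (⟦_⟧ ∘ (C ∩ inside (Z₀ -ₑ v))) _))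
          where
          lem : ∀ c p q r s → ⟦ c ∧ p ∧ q ⟧ ≤
                ⟦ c ∧ (p ∧ not r) ∧ (q ∧ not s) ⟧ + ⟦ c ∧ (p ∧ q) ∧ (r ∨ s) ⟧
          lem = toWitness {a? = ∀ᵇ λ _ → ∀ᵇ λ _ → ∀ᵇ λ _ → ∀ᵇ λ _ → ∀ᵇ λ _ → _ ≤? _} _
          pt : ∀ g → ⟦ (C ∩ inside Z₀) g ⟧ ≤ ⟦ (C ∩ inside (Z₀ -ₑ v)) g ⟧ + ⟦ (C ∩ Q) g ⟧
          pt g rewrite ==-sym v (a g) | ==-sym v (b g) =
            lem (C g) (Z₀ (a g)) (Z₀ (b g)) (a g == v) (b g == v)

      f : Edge G
      f = proj₁ exchanged
      C-f : C f ≡ true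
      C-f = proj₁ (∧⁻ (C f) (proj₂ exchanged))
      Z-f : inside Z₀ f ≡ true
      Z-f = proj₁ (∧⁻ (inside Z₀ f) (proj₂ (∧⁻ (C f) (proj₂ exchanged))))
      v-f : inc v f ≡ true
      v-f = proj₂ (∧⁻ (inside Z₀ f) (proj₂ (∧⁻ (C f) (proj₂ exchanged))))

      C′ : Sub (size G)
      C′ = (C -ₑ f) +ₑ e

      C-f-e : (C -ₑ f) e ≡ false
      C-f-e = cong (_∧ not (e == f)) C-e

      #-C′ : ∀ P → # (C′ ∩ P) + ⟦ P f ⟧ ≡ # (C ∩ P) + ⟦ P e ⟧
      #-C′ P = begin
        # (C′ ∩ P) + ⟦ P f ⟧                     ≡⟨ cong (_+ ⟦ P f ⟧) (#-insert (C -ₑ f) P C-f-e) ⟩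
        # ((C -ₑ f) ∩ P) + ⟦ P e ⟧ + ⟦ P f ⟧     ≡⟨ swap-last (# ((C -ₑ f) ∩ P)) _ _ ⟩
        # ((C -ₑ f) ∩ P) + ⟦ P f ⟧ + ⟦ P e ⟧     ≡⟨ cong (_+ ⟦ P e ⟧) (#-delete C P C-f) ⟨
        # (C ∩ P) + ⟦ P e ⟧                      ∎
        where
        open ≡-Reasoning
        swap-last : ∀ p q r → p + q + r ≡ p + r + q
        swap-last p q r = solve (p ∷ q ∷ r ∷ [])

      C′-sparse : Sparse m C′
      C′-sparse Y z Yz = cases (inside Y e) (inside Y f) refl refl (#-C′ (inside Y))
        where
        arith₀ : ∀ p q r M → p + q ≡ r + 0 → r + m ≤ M → p + m ≤ M
        arith₀ p q r M h₁ h₂ = ≤-from q (+-mono-≤ (≤-reflexive h₁) h₂) (solve (p ∷ q ∷ r ∷ M ∷ m ∷ []))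
        arith₁ : ∀ p r M → p + 1 ≡ r + 1 → r + m ≤ M → p + m ≤ M
        arith₁ p r M h₁ h₂ = ≤-from 0 (+-mono-≤ (≤-reflexive h₁) h₂) (solve (p ∷ r ∷ M ∷ m ∷ []))
        arith₂ : ∀ p r M → p + 0 ≡ r + 1 → r + m < M → p + m ≤ M
        arith₂ p r M h₁ h₂ = ≤-from 0 (+-mono-≤ (≤-reflexive h₁) h₂) (solve (p ∷ r ∷ M ∷ m ∷ []))
        cases : ∀ p q → inside Y e ≡ p → inside Y f ≡ q → i C′ Y + ⟦ q ⟧ ≡ i C Y + ⟦ p ⟧ → i C′ Y + m ≤ m * # Y
        cases false q    _ _ eq = arith₀ (i C′ Y) ⟦ q ⟧ (i C Y) (m * # Y) eq (C-sparse Y z Yz)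
        cases true true  _ _ eq = arith₁ (i C′ Y) (i C Y) (m * # Y) eq (C-sparse Y z Yz)
        -- Only a tight `Y` around `e` could violate sparsity. Then `Z₀ ∩ Y` is tight around `e` as
        -- well, minimality gives `Z₀ ⊆ Y`, and `f` lies inside `Y` after all.
        cases true false Ye Yf eq = arith₂ (i C′ Y) (i C Y) (m * # Y) eq (≰⇒> λ tight-Y → contradiction (trans (sym Yf) (Z⊆Y tight-Y)) λ ())
          where
          Z⊆Y : Tight m C Y → inside Y f ≡ true
          Z⊆Y tight-Y with Yx , Yy ← ends-in Y joins Ye with Za , Zb ← ∧⁻ (Z₀ (a f)) Z-f =
            ∧⁺ (sub (a f) Za) (sub (b f) Zb)
            where
            Z′ : TightAround S C x y
            Z′ = record { Z⊆ = λ w p → Z⊆ w (proj₁ (∧⁻ (Z₀ w) p)) ; Z-x = ∧⁺ Z-x Yx ; Z-y = ∧⁺ Z-y Yy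
                        ; tight = tight-∩ m C C-sparse tight tight-Y x Z-x Yx }
            sub : Z₀ ⊆ Y
            sub w Zw = proj₂ (∧⁻ (Z₀ w) (#-⊆-≥ {X = Z₀ ∩ Y} (λ u p → proj₁ (∧⁻ (Z₀ u) p)) (minimal Z′) w Zw))

      C′-feasible : Feasible C′
      C′-feasible = record { sparse = C′-sparse ; degrees = λ w → cases w (inc w e) refl (#-C′ (inc w)) }
        where
        arith : ∀ {p q r M} → p + q ≡ r → r ≤ M → p ≤ M
        arith h₁ h₂ = ≤-trans (m≤m+n _ _) (≤-trans (≤-reflexive h₁) h₂)
        cases : ∀ w c → inc w e ≡ c → deg C′ w + ⟦ inc w f ⟧ ≡ deg C w + ⟦ c ⟧ → deg C′ w ≤ η w
        cases w false _ eq = arith (trans eq (+-identityʳ _)) (degrees (Candidate.feasible cand) w)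
        cases w true  p eq with inc-joins w joins p
        ... | inj₁ refl = arith (trans eq (+-comm _ 1)) deg-x
        ... | inj₂ refl = arith (trans eq (+-comm _ 1)) deg-y

      C′-deg : deg C′ v < η v
      C′-deg = subst (_≤ η v) (trans (sym (+-identityʳ _)) (trans (sym eq) (+-comm _ 1)))
        (degrees (Candidate.feasible cand) v)
        where
        v∌e : inc v e ≡ false
        v∌e = ¬-not λ p → [ v≢x , v≢y ] (inc-joins v joins p)
        eq : deg C′ v + 1 ≡ deg C v + 0
        eq = subst₂ (λ p q → deg C′ v + ⟦ p ⟧ ≡ deg C v + ⟦ q ⟧) v-f v∌e (#-C′ (inc v))

      same-#′ : # C′ ≡ # B
      same-#′ = trans (+-cancelʳ-≡ 1 (# C′) (# C)
        (subst₂ (λ p q → p + 1 ≡ q + 1) (#-cong λ g → ∧-identityʳ (C′ g)) (#-cong λ g → ∧-identityʳ (C g)) (#-C′ ⊤))) same-#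

      -- `C` may differ from `B` inside `X` and inside `Y`, and `C′` from `C` inside `Z₀`. Since
      -- `Z₀` meets `X` in `x` and `Y` in `y`, the union is tight.
      W : Sub (order G)
      W = X ∪ (Y ∪ Z₀)

      W-tight-C : Tight m C W
      W-tight-C = tight-∪ m C C-sparse tight-X
        (tight-∪ m C C-sparse tight-Y tight y Y-y Z-y) x X-x (∨⁺ʳ (Y x) Z-x)

      Z⊆W : Z₀ ⊆ W
      Z⊆W w p = ∨⁺ʳ (X w) (∨⁺ʳ (Y w) p)

      C-agrees : AgreesOff W C
      C-agrees g p = agrees g (outside {X} {W} (λ w q → ∨⁺ˡ ((Y ∪ Z₀) w) q) g p)
                              (outside {Y} {W} (λ w q → ∨⁺ʳ (X w) (∨⁺ˡ (Z₀ w) q)) g p)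

      C′-agrees : AgreesOff W C′
      C′-agrees g p = trans (unchanged (dec-false (g ≟ f) g≢f) (dec-false (g ≟ e) g≢e)) (C-agrees g p)
        where
        off-Z : inside Z₀ g ≡ false
        off-Z = outside {Z₀} {W} Z⊆W g p
        g≢f : g ≢ f
        g≢f refl = contradiction (trans (sym Z-f) off-Z) λ ()
        g≢e : g ≢ e
        g≢e refl = contradiction (trans (sym (trans (inside-joins Z₀ joins) (∧⁺ Z-x Z-y))) off-Z) λ ()
        unchanged : (g == f) ≡ false → (g == e) ≡ false → C′ g ≡ C g
        unchanged p q rewrite p | q = trans (∨-identityʳ _) (∧-identityʳ _)

      desaturated : Desaturable S v
      desaturated = record
        { X⊆ = W⊆ ; X-v = Z⊆W v Z-v
        ; tight = subst (λ s → m * # W ≤ s + m) (i-agree {W} {C} C-agrees same-#) W-tight-C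
        ; feasible = C′-feasible ; same-# = same-#′ ; agrees = C′-agrees ; deg< = C′-deg }
        where
        W⊆ : W ⊆ ∁ S
        W⊆ w p with ∨⁻ (X w) p
        ... | inj₁ q = X⊆ w q
        ... | inj₂ q with ∨⁻ (Y w) q
        ...   | inj₁ r = Y⊆ w r
        ...   | inj₂ r = Z⊆ w r

    -- A minimal tight set around a candidate edge cannot contain `v`, since an exchange inside it
    -- would desaturate `v`. Such a set therefore also blocks for `S +ₑ v`.
    obstruct : ∀ {S v} → Obstruction S → S v ≡ false → ¬ Desaturable S v → Obstruction (S +ₑ v)
    obstruct {S} {v} obs Sv ¬des = record { saturated = λ w p → sat w (∨⁻ (S w) p) ; blocked = blocked′ }
      where
      open Obstruction obs
      sat : ∀ w → S w ≡ true ⊎ (w == v) ≡ true → η w ≤ deg B w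
      sat w (inj₁ p) = saturated w p
      sat w (inj₂ p) = subst (λ u → η u ≤ deg B u) (sym (==⇒≡ p)) (¬desaturable⇒saturated Sv ¬des)

      avoids : ∀ {X u} → X ⊆ ∁ (S +ₑ v) → X u ≡ true → v ≢ u
      avoids {u = u} X⊆ Xu refl with () ← trans (sym (X⊆ u Xu)) (cong not (∨⁺ʳ (S u) (==-refl u)))

      blocked′ : ∀ {C e x y} → Candidate (S +ₑ v) C e x y → ¬ ¬ TightAround (S +ₑ v) C x y
      blocked′ {C} {e} {x} {y} cand none = blocked (weaken cand) λ Z₁ →
        ¬¬-minimal (λ Z → # (TightAround.Z Z)) Z₁ λ (Z , minimal) → avoid Z minimal (TightAround.Z Z v) refl
        where
        open Candidate cand
        avoid : (Z : TightAround S C x y) → (∀ Z′ → # (TightAround.Z Z) ≤ # (TightAround.Z Z′)) →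
                ∀ c → TightAround.Z Z v ≡ c → ⊥
        avoid Z minimal true  Zv = ¬des (Exchange.desaturated (weaken cand) (avoids {X} X⊆ X-x) (avoids {Y} Y⊆ Y-y) Z Zv minimal)
        avoid Z minimal false Zv = none record { TightAround Z ; Z⊆ = λ w p → cong not
          (trans (cong (_∨ (w == v)) (S-w w p)) (dec-false (w ≟ v) λ { refl → contradiction (trans (sym p) Zv) λ () })) }
          where
          S-w : ∀ w → TightAround.Z Z w ≡ true → S w ≡ false
          S-w w p with S w | TightAround.Z⊆ Z w p
          ... | false | _ = refl

    maximal-obstruction : ¬ ¬ (Σ[ S ∈ Sub (order G) ] Obstruction S × (∀ v → S v ≡ false → ¬ ¬ Desaturable S v))
    maximal-obstruction κ = go (# 𝕍) (λ _ → false) no-obstruction (#-mono λ _ _ → refl)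
      where
      go : ∀ s S → Obstruction S → # (∁ S) ≤ s → ⊥
      go s S obs le = ¬¬-excluded-middle λ
        { (no none) → κ (S , obs , λ v Sv ¬des → none (v , Sv , ¬des))
        ; (yes (v , Sv , ¬des)) → larger s le v Sv ¬des }
        where
        larger : ∀ s → # (∁ S) ≤ s → ∀ v → S v ≡ false → ¬ Desaturable S v → ⊥
        larger zero    le v Sv ¬des = contradiction (≤-trans (#-pos {X = ∁ S} v (cong not Sv)) le) λ ()
        larger (suc s) le v Sv ¬des = go s (S +ₑ v) (obstruct obs Sv ¬des)
          (≤-pred (≤-trans (#-strict smaller v (cong not Sv)
            (cong not (∨⁺ʳ (S v) (==-refl v)))) le))
          where
          smaller : ∁ (S +ₑ v) ⊆ ∁ S
          smaller w p with S w
          ... | false = refl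

-- The least element of X, provided d is an element.
first : (X : Sub n) → Fin n → Fin n
first X zero    = zero
first X (suc d) = if X zero then zero else suc (first (X ∘ suc) d)

first-∈ : (X : Sub n) (d : Fin n) → X d ≡ true → X (first X d) ≡ true
first-∈ X zero    p = p
first-∈ X (suc d) p with X zero in eq
... | true  = eq
... | false = first-∈ (X ∘ suc) d p

-- The default only certifies nonemptiness; the representative depends on the set alone.
first-cong : {X Y : Sub n} → X ≗ Y → ∀ d d′ → X d ≡ true → Y d′ ≡ true → first X d ≡ first Y d′
first-cong h zero    zero     p q = refl
first-cong h zero    (suc d′) p q rewrite trans (sym (h zero)) p = refl
first-cong h (suc d) zero     p q rewrite trans (h zero) q = refl
first-cong {X = X} {Y} h (suc d) (suc d′) p q rewrite h zero with Y zero
... | true  = refl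
... | false = cong suc (first-cong (h ∘ suc) d d′ p q)

image : Sub n → (Fin n → Fin k) → Sub k
image X f j = does (any? λ v → (X v ≟ᵇ true) ×-dec (f v ≟ j))

∈-image⁺ : (X : Sub n) (f : Fin n → Fin k) {v : Fin n} → X v ≡ true → image X f (f v) ≡ true
∈-image⁺ X f {v} Xv = dec-true (any? _) (v , Xv , refl)

∈-image⁻ : (X : Sub n) (f : Fin n → Fin k) {j : Fin k} → image X f j ≡ true → ∃[ v ] X v ≡ true × f v ≡ j
∈-image⁻ X f {j} p with yes q ← any? (λ v → (X v ≟ᵇ true) ×-dec (f v ≟ j)) = q

#-image : (X : Sub n) (f : Fin n → Fin k) → # (image X f) ≤ # X
#-image X f = ≤-trans (sum-mono bound) (≤-reflexive
  (trans (sum-swap (λ j v → ⟦ j == f v ⟧ * ⟦ X v ⟧)) (sum-cong λ v → sum-point (f v) (λ _ → ⟦ X v ⟧))))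
  where
  bound : ∀ j → ⟦ image X f j ⟧ ≤ sum (λ v → ⟦ j == f v ⟧ * ⟦ X v ⟧)
  bound j with image X f j in p
  ... | false = z≤n
  ... | true with v , Xv , refl ← ∈-image⁻ X f p = ≤-trans (#-pos {X = λ w → (j == f w) ∧ X w} v (∧⁺ (==-refl j) Xv))
      (≤-reflexive (sum-cong λ w → lem (j == f w) (X w)))
    where
    lem : ∀ p q → ⟦ p ∧ q ⟧ ≡ ⟦ p ⟧ * ⟦ q ⟧
    lem = toWitness {a? = ∀ᵇ λ _ → ∀ᵇ λ _ → _ ≟ℕ _} _

-- Counting the edges of a largest feasible set against a partition

module Crossing (G : Graph) where
  open Sparsity G

  crossing : Sub (order G) → (Vertex G → Fin k) → Sub (size G)
  crossing S ℓ e = inside (∁ S) e ∧ not (ℓ (proj₁ (ends G e)) == ℓ (proj₂ (ends G e)))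

  -- ℓ encodes a partition of V ∖ S: m p ≤ e + |S| + m in step (1).
  PartitionBound : ℕ → Set
  PartitionBound m = ∀ S {k} (ℓ : Vertex G → Fin k) → m * # (image (∁ S) ℓ) ≤ # (crossing S ℓ) + # S + m

module Augmenting (G : Graph) (m : ℕ) (η : Vertex G → ℕ) (m≥1 : 1 ≤ m)
  (B : Sub (size G)) (B-feasible : Rearranging.Feasible G m η B)
  (maximal : ∀ C → Rearranging.Feasible G m η C → # C ≤ # B) where

  open Sparsity G
  open Crossing G
  open Incidence G
  open Rearranging G m η
  open Blocking m≥1 B B-feasible maximal

  private
    a b : Edge G → Vertex G
    a = proj₁ ∘ ends G
    b = proj₂ ∘ ends G

  module _ {S : Sub (order G)} (obs : Obstruction S) (des : ∀ v → S v ≡ false → ¬ ¬ Desaturable S v) where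

    open Obstruction obs

    module Combine {e : Edge G} (B-e : B e ≡ false)
      (dx : Desaturable S (a e)) (dy : Desaturable S (b e)) where

      open Desaturable dx renaming (C to Cx; X-v to X-x; tight to tight-x; feasible to feasible-x;
                                    same-# to same-x; agrees to agrees-x; deg< to deg-x)
      open Desaturable dy renaming (X to Y; X⊆ to Y⊆; C to Cy; X-v to Y-y; tight to tight-y; feasible to feasible-y;
                                    same-# to same-y; agrees to agrees-y; deg< to deg-y)

      overlapping : 1 ≤ # (X ∩ Y) → TightAround S B (a e) (b e)
      overlapping p with z , XYz ← #-witness (X ∩ Y) p with Xz , Yz ← ∧⁻ (X z) XYz = record
        { Z = X ∪ Y ; Z⊆ = ⊆S ; Z-x = ∨⁺ˡ (Y (a e)) X-x ; Z-y = ∨⁺ʳ (X (b e)) Y-y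
        ; tight = tight-∪ m B (Feasible.sparse B-feasible) tight-x tight-y z Xz Yz }
        where
        ⊆S : (X ∪ Y) ⊆ ∁ S
        ⊆S w p with ∨⁻ (X w) p
        ... | inj₁ q = X⊆ w q
        ... | inj₂ q = Y⊆ w q

      -- Take `Cx` inside `X` and `Cy` elsewhere. As `X` and `Y` are disjoint, `a e` keeps its
      -- lowered degree from `Cx` and `b e` its lowered degree from `Cy`, so that `e` becomes a
      -- candidate.
      module Disjoint (X∩Y=∅ : ¬ 1 ≤ # (X ∩ Y)) where

        X⇒¬Y : ∀ {w} → X w ≡ true → Y w ≡ false
        X⇒¬Y {w} Xw = ¬-not λ Yw → X∩Y=∅ (#-pos {X = X ∩ Y} w (∧⁺ Xw Yw))

        inX⇒¬inY : ∀ {f} → inside X f ≡ true → inside Y f ≡ false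
        inX⇒¬inY {f} p = cong (_∧ Y (b f)) (X⇒¬Y (proj₁ (∧⁻ (X (a f)) p)))

        C : Sub (size G)
        C = splice X Cx Cy

        C-in : ∀ {f} → inside X f ≡ true → C f ≡ Cx f
        C-in p rewrite p = refl

        C-out : ∀ {f} → inside X f ≡ false → C f ≡ Cy f
        C-out p rewrite p = refl

        i-local : ∀ {D D′} P → (∀ f → inside P f ≡ true → D f ≡ D′ f) → i D P ≡ i D′ P
        i-local {D} {D′} P h = #-cong pt
          where
          pt : (D ∩ inside P) ≗ (D′ ∩ inside P)
          pt f with inside P f in Pf
          ... | true  = cong (_∧ true) (h f Pf)
          ... | false = trans (∧-zeroʳ (D f)) (sym (∧-zeroʳ (D′ f)))

        i-Cy : i Cy X ≡ i B X
        i-Cy = i-local X λ f p → agrees-y f (inX⇒¬inY p)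

        i-C : i C X ≡ i B X
        i-C = trans (i-local X λ f → C-in) (i-agree {X} {Cx} agrees-x same-x)

        i-C-Y : i C Y ≡ i B Y
        i-C-Y = trans (i-local Y λ f p → C-out (¬-not λ q → contradiction (trans (sym p) (inX⇒¬inY q)) λ ()))
                      (i-agree {Y} {Cy} agrees-y same-y)

        tight-by : ∀ {D D′} P → i D P ≡ i D′ P → Tight m D′ P → Tight m D P
        tight-by P eq = subst (λ s → m * # P ≤ s + m) (sym eq)

        same-C : # C ≡ # B
        same-C = trans (#-by-inside C) (trans (cong₂ _+_ (trans i-C (sym i-Cy)) (#-cong pt)) (trans (sym (#-by-inside Cy)) same-y))
          where
          #-by-inside : ∀ D → # D ≡ i D X + # (∁ (inside X) ∩ D)
          #-by-inside D = trans (#-split D (inside X)) (cong (_+ # (∁ (inside X) ∩ D)) (#-cong λ f → ∧-comm (inside X f) (D f)))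
          pt : (∁ (inside X) ∩ C) ≗ (∁ (inside X) ∩ Cy)
          pt f with inside X f
          ... | true  = refl
          ... | false = refl

        deg-local : ∀ {D D′} v → (∀ f → inc v f ≡ true → D f ≡ D′ f) → deg D v ≡ deg D′ v
        deg-local {D} {D′} v h = #-cong pt
          where
          pt : (D ∩ inc v) ≗ (D′ ∩ inc v)
          pt f with inc v f in p
          ... | true  = cong (_∧ true) (h f p)
          ... | false = trans (∧-zeroʳ (D f)) (sym (∧-zeroʳ (D′ f)))

        deg-in : ∀ {v} → X v ≡ true → deg C v ≡ deg Cx v
        deg-in {v} Xv = deg-local v λ f p → pt f p (inside X f) refl
          where
          pt : ∀ f → inc v f ≡ true → ∀ c → inside X f ≡ c → C f ≡ Cx f
          pt f p true  q = C-in q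
          -- Since `v` is in `X`, an edge at `v` is not inside `Y`; not being inside `X` either, it
          -- has the same status in `B`, `Cx` and `Cy`.
          pt f p false q = trans (C-out q) (trans
            (agrees-y f (¬-not λ r → contradiction (trans (sym (inc-inside Y p r)) (X⇒¬Y Xv)) λ ()))
            (sym (agrees-x f q)))

        deg-out : ∀ {v} → X v ≡ false → deg C v ≡ deg Cy v
        deg-out {v} Xv = deg-local v λ f p → C-out (¬-not λ r → contradiction (trans (sym (inc-inside X p r)) Xv) λ ())

        degrees : ∀ v → deg C v ≤ η v
        degrees v with X v in Xv
        ... | true  = subst (_≤ η v) (sym (deg-in Xv)) (Feasible.degrees feasible-x v)
        ... | false = subst (_≤ η v) (sym (deg-out Xv)) (Feasible.degrees feasible-y v)

        C-sparse : Sparse m C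
        C-sparse = sparse-splice m (Feasible.sparse feasible-x) (Feasible.sparse feasible-y) (tight-by {Cy} {B} X i-Cy tight-x)

        X-y : X (b e) ≡ false
        X-y = ¬-not λ p → contradiction (trans (sym Y-y) (X⇒¬Y p)) λ ()

        candidate : Candidate S C e (a e) (b e)
        candidate = record
          { X⊆ = X⊆ ; Y⊆ = Y⊆ ; X-x = X-x ; Y-y = Y-y
          ; tight-X = tight-by {C} {B} X i-C tight-x ; tight-Y = tight-by {C} {B} Y i-C-Y tight-y
          ; feasible = record { sparse = C-sparse ; degrees = degrees }
          ; same-# = same-C
          ; agrees = λ f p q → trans (C-out p) (agrees-y f q)
          ; joins = inj₁ refl
          ; C-e = trans (C-out (trans (cong (X (a e) ∧_) X-y) (∧-zeroʳ _)))
                        (trans (agrees-y e (cong (_∧ Y (b e)) (X⇒¬Y X-x))) B-e)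
          ; deg-x = subst (_< η (a e)) (sym (deg-in X-x)) deg-x
          ; deg-y = subst (_< η (b e)) (sym (deg-out X-y)) deg-y
          }

        -- A set tight for `C` need not be tight for `B`. Joining `X` and `Y` to it encloses all
        -- differences between the two, and `i-agree` applies.
        enlarge : TightAround S C (a e) (b e) → TightAround S B (a e) (b e)
        enlarge around = record
          { Z = W ; Z⊆ = W⊆ ; Z-x = ∨⁺ˡ _ X-x ; Z-y = ∨⁺ʳ (X (b e)) (∨⁺ˡ _ Y-y)
          ; tight = subst (λ s → m * # W ≤ s + m) (i-agree {W} {C} C-agrees same-C)
              (tight-∪ m C C-sparse (Candidate.tight-X candidate)
                (tight-∪ m C C-sparse (Candidate.tight-Y candidate) tight (b e) Y-y Z-y)
                (a e) X-x (∨⁺ʳ (Y (a e)) Z-x)) }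
          where
          open TightAround around
          W : Sub (order G)
          W = X ∪ (Y ∪ Z)
          C-agrees : AgreesOff W C
          C-agrees f p = Candidate.agrees candidate f
            (outside {X} {W} (λ w → ∨⁺ˡ ((Y ∪ Z) w)) f p)
            (outside {Y} {W} (λ w q → ∨⁺ʳ (X w) (∨⁺ˡ (Z w) q)) f p)
          W⊆ : W ⊆ ∁ S
          W⊆ w p with ∨⁻ (X w) p
          ... | inj₁ q = X⊆ w q
          ... | inj₂ q with ∨⁻ (Y w) q
          ...   | inj₁ r = Y⊆ w r
          ...   | inj₂ r = Z⊆ w r

    -- Both ends can be desaturated. If the two tight sets overlap, their union already encloses
    -- `e`; if they are disjoint, they yield a candidate, whose blocking set is enlarged to one
    -- tight for `B`.
    closed-up : ∀ e → B e ≡ false → S (a e) ≡ false → S (b e) ≡ false → ¬ ¬ TightAround S B (a e) (b e)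
    closed-up e Be Sa Sb none = des (a e) Sa λ dx → des (b e) Sb λ dy →
      let open Combine Be dx dy in cases (λ p → none (overlapping p))
        λ p → blocked (Disjoint.candidate p) λ Z → none (Disjoint.enlarge p Z)
      where
      cases : ∀ {A : Set} → (A → ⊥) → (¬ A → ⊥) → ⊥
      cases f g = g f

    record MaximalTight (v : Vertex G) (M : Sub (order G)) : Set where
      field
        M⊆    : M ⊆ ∁ S
        M-v   : M v ≡ true
        tight : Tight m B M
        max   : ∀ {Z} → Z ⊆ ∁ S → Z v ≡ true → Tight m B Z → Z ⊆ M

    -- `TightAround S B v v` serves as the type of tight sets through `v`. One with the least
    -- complement absorbs all others, as unions with it are tight.
    maximal-tight : ∀ v → S v ≡ false → ¬ ¬ ∃ (MaximalTight v)
    maximal-tight v Sv κ = ¬¬-minimal (λ Z → # (∁ (TightAround.Z Z))) trivial λ (Z , least) →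
      let module Z = TightAround Z in κ (Z.Z , record
      { M⊆ = Z.Z⊆ ; M-v = Z.Z-x ; tight = Z.tight
      ; max = λ {Y} Y⊆ Yv tY w Yw → not-injective (¬-not λ p → contradiction
          (trans (sym (#-⊆-≥ {X = ∁ (Z.Z ∪ Y)} {∁ Z.Z} (λ u → anti (Z.Z u)) (least record
            { Z = Z.Z ∪ Y ; Z⊆ = λ u q → both (Z.Z⊆ u) (Y⊆ u) (∨⁻ (Z.Z u) q)
            ; Z-x = ∨⁺ˡ (Y v) Z.Z-x ; Z-y = ∨⁺ˡ (Y v) Z.Z-x
            ; tight = tight-∪ m B (Feasible.sparse B-feasible) Z.tight tY v Z.Z-x Yv }) w p))
            (cong not (∨⁺ʳ (Z.Z w) Yw))) λ ()) })
      where
      anti : ∀ c {d} → not (c ∨ d) ≡ true → not c ≡ true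
      anti false _ = refl
      both : ∀ {c d p} → (c ≡ true → p ≡ true) → (d ≡ true → p ≡ true) → c ≡ true ⊎ d ≡ true → p ≡ true
      both f g = [ f , g ]
      trivial : TightAround S B v v
      trivial = record
        { Z = ｛ v ｝ ; Z⊆ = λ w p → trans (cong (not ∘ S) (==⇒≡ p)) (cong not Sv)
        ; Z-x = ==-refl v ; Z-y = ==-refl v ; tight = tight-point m B v }

    module Labelling (M : Vertex G → Sub (order G)) (mt : ∀ v → S v ≡ false → MaximalTight v (M v)) where

      M-cong : ∀ {v w} → S v ≡ false → M v w ≡ true → M v ≗ M w
      M-cong {v} {w} Sv vw = ⊆-antisym (Mw.max Mv.M⊆ vw Mv.tight)
        (Mv.max Mw.M⊆ (Mw.max Mv.M⊆ vw Mv.tight v Mv.M-v) Mw.tight)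
        where
        module Mv = MaximalTight (mt v Sv)
        module Mw = MaximalTight (mt w (not-injective (Mv.M⊆ w vw)))

      -- The least element names the class. Outside `S`, labels agree exactly for vertices with the
      -- same maximal tight set; on `S` they are irrelevant.
      ℓ : Vertex G → Vertex G
      ℓ v = first (M v) v

      ℓ-∈ : ∀ {v} → S v ≡ false → M v (ℓ v) ≡ true
      ℓ-∈ {v} Sv = first-∈ (M v) v (MaximalTight.M-v (mt v Sv))

      ℓ-complete : ∀ {v w} → S v ≡ false → M v w ≡ true → ℓ v ≡ ℓ w
      ℓ-complete {v} {w} Sv vw = first-cong (M-cong Sv vw) v w (MaximalTight.M-v (mt v Sv))
        (trans (sym (M-cong Sv vw w)) vw)

      ℓ-sound : ∀ {v w} → S v ≡ false → S w ≡ false → ℓ v ≡ ℓ w → M v w ≡ true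
      ℓ-sound {v} {w} Sv Sw eq = trans (M-cong Sv (ℓ-∈ Sv) w) (trans (cong (λ j → M j w) eq)
        (trans (sym (M-cong Sw (ℓ-∈ Sw) w)) (MaximalTight.M-v (mt w Sw))))

      P : Vertex G → Sub (order G)
      P j v = not (S v) ∧ (j == ℓ v)

      -- A nonempty class is a maximal tight set. The factor on the right drops the offset `m` for
      -- labels not in use, so the sum over all `j` charges `m` once per class.
      P-tight : ∀ j → m * # (P j) ≤ i B (P j) + m * ⟦ image (∁ S) ℓ j ⟧
      P-tight j with 1 ≤? # (P j)
      ... | no ¬p = ≤-trans (≤-reflexive (trans (cong (m *_) (n≤0⇒n≡0 (≤-pred (≰⇒> ¬p)))) (*-zeroʳ m))) z≤n
      ... | yes p with v , Pv ← #-witness (P j) p with ¬Sv , jv ← ∧⁻ (not (S v)) Pv =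
        subst₂ _≤_ (cong (m *_) (#-cong (sym ∘ P≗M)))
          (cong₂ _+_ (i-cong B (sym ∘ P≗M)) (sym (trans (cong (λ c → m * ⟦ c ⟧) j-used) (*-identityʳ m))))
          (MaximalTight.tight (mt v Sv))
        where
        Sv : S v ≡ false
        Sv = not-injective ¬Sv
        j-used : image (∁ S) ℓ j ≡ true
        j-used = dec-true (any? _) (v , ¬Sv , sym (==⇒≡ jv))
        P⊆M : P j ⊆ M v
        P⊆M w p with ¬Sw , jw ← ∧⁻ (not (S w)) p =
          ℓ-sound Sv (not-injective ¬Sw) (trans (sym (==⇒≡ {x = j} jv)) (==⇒≡ jw))
        M⊆P : M v ⊆ P j
        M⊆P w p = ∧⁺ (MaximalTight.M⊆ (mt v Sv) w p)
          (dec-true (j ≟ ℓ w) (trans (==⇒≡ jv) (ℓ-complete Sv p)))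
        P≗M : P j ≗ M v
        P≗M = ⊆-antisym P⊆M M⊆P

      same : Sub (size G)
      same e = inside (∁ S) e ∧ (ℓ (a e) == ℓ (b e))

      sum-P : sum (λ j → # (P j)) ≡ # (∁ S)
      sum-P = trans (sum-swap (λ j v → ⟦ P j v ⟧)) (sum-cong λ v → trans (sum-cong λ j → lem (not (S v)) (j == ℓ v))
        (sum-point (ℓ v) (λ _ → ⟦ not (S v) ⟧)))
        where
        lem : ∀ p q → ⟦ p ∧ q ⟧ ≡ ⟦ q ⟧ * ⟦ p ⟧
        lem = toWitness {a? = ∀ᵇ λ _ → ∀ᵇ λ _ → _ ≟ℕ _} _

      sum-i : sum (λ j → i B (P j)) ≡ # (B ∩ same)
      sum-i = trans (sum-swap (λ j e → ⟦ B e ∧ inside (P j) e ⟧)) (sum-cong λ e →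
        trans (sum-cong λ j → lem (B e) (not (S (a e))) (not (S (b e))) (j == ℓ (a e)) (j == ℓ (b e)))
              (sum-point (ℓ (a e)) (λ j → ⟦ B e ∧ inside (∁ S) e ∧ (j == ℓ (b e)) ⟧)))
        where
        lem : ∀ c p q r s → ⟦ c ∧ (p ∧ r) ∧ (q ∧ s) ⟧ ≡ ⟦ r ⟧ * ⟦ c ∧ (p ∧ q) ∧ s ⟧
        lem = toWitness {a? = ∀ᵇ λ _ → ∀ᵇ λ _ → ∀ᵇ λ _ → ∀ᵇ λ _ → ∀ᵇ λ _ → _ ≟ℕ _} _

      -- By `closed-up`, an edge missing from `B` lies in a tight set avoiding `S`, and so within
      -- one class.
      crossing⊆B : crossing S ℓ ⊆ B
      crossing⊆B e p with B e in Be
      ... | true = refl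
      ... | false with in∁ , ℓ≢ ← ∧⁻ (inside (∁ S) e) p with Sa , Sb ← ∧⁻ (not (S (a e))) in∁ =
        ⊥-elim (closed-up e Be (not-injective Sa) (not-injective Sb) λ Z →
          contradiction (trans (sym ℓ≢) (cong not (dec-true (_ ≟ _) (ℓ-complete (not-injective Sa)
            (MaximalTight.max (mt (a e) (not-injective Sa)) (TightAround.Z⊆ Z) (TightAround.Z-x Z) (TightAround.tight Z)
              (b e) (TightAround.Z-y Z)))))) λ ())

      -- Summing `P-tight` over the labels bounds `m * # (∁ S)` through the edges of `B` within
      -- classes. The crossing edges also belong to `B`, and the two kinds together make up
      -- `i B (∁ S)`.
      partition-count : m * # (∁ S) + # (crossing S ℓ) ≤ i B (∁ S) + m * # (image (∁ S) ℓ)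
      partition-count = arith (# (crossing S ℓ)) (# (B ∩ crossing S ℓ)) (i B (∁ S)) (m * # (image (∁ S) ℓ)) (# (B ∩ same)) (m * # (∁ S))
        (subst₂ _≤_ (trans (sum-* m (λ j → # (P j))) (cong (m *_) sum-P))
          (trans (sum-+ (λ j → i B (P j)) _) (cong₂ _+_ sum-i (sum-* m (⟦_⟧ ∘ image (∁ S) ℓ)))) (sum-mono P-tight))
        split (#-mono λ e p → ∧⁺ (crossing⊆B e p) p)
        where
        arith : ∀ x bx u c s U → U ≤ s + c → s + bx ≡ u → x ≤ bx → U + x ≤ u + c
        arith x bx _ c s U h₁ refl h₂ = ≤-from 0 (+-mono-≤ h₁ h₂) (solve (x ∷ bx ∷ c ∷ s ∷ U ∷ []))
        split : # (B ∩ same) + # (B ∩ crossing S ℓ) ≡ i B (∁ S)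
        split = trans (sym (sum-+ (⟦_⟧ ∘ (B ∩ same)) _)) (sum-cong λ e → lem (B e) (inside (∁ S) e) (ℓ (a e) == ℓ (b e)))
          where
          lem : ∀ p q r → ⟦ p ∧ q ∧ r ⟧ + ⟦ p ∧ q ∧ not r ⟧ ≡ ⟦ p ∧ q ⟧
          lem = toWitness {a? = ∀ᵇ λ _ → ∀ᵇ λ _ → ∀ᵇ λ _ → _ ≟ℕ _} _

    tight-families : ¬ ¬ (∀ v → ∃[ M ] (S v ≡ false → MaximalTight v M))
    tight-families = ¬¬-choice choose
      where
      choose : ∀ v → ¬ ¬ (∃[ M ] (S v ≡ false → MaximalTight v M))
      choose v with S v in Sv
      ... | true  = λ κ → κ (𝕍 , λ ())
      ... | false = λ κ → maximal-tight v Sv λ (M , mt) → κ (M , λ _ → mt)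

  -- Let U be the complement of S. The partition count and `bound` give m |U| ≤ i_B(U) + |S| + m.
  -- Counting degrees at the saturated vertices, i_B(U) ≤ |B| + i_B(S) - (2 m + 1) |S| + m [u ∈ S],
  -- which by `inner` is at most |B| - (m + 1) |S|. Together m (|S| + |U|) ≤ |B| + m, so `𝕍` would
  -- be tight.
  ¬stuck : PartitionBound m → ¬ Tight m B 𝕍 → (u : Vertex G) →
           (∀ S → sum (λ v → ⟦ S v ⟧ * η v) + m * ⟦ S u ⟧ ≡ (2 * m + 1) * # S) → ⊥
  ¬stuck bound loose u sum-η = maximal-obstruction λ (S , obs , des) → tight-families obs des λ M →
    let open Labelling obs des (proj₁ ∘ M) (proj₂ ∘ M)
    in arith (# (crossing S ℓ)) (m * # (image (∁ S) ℓ)) (i B (∁ S)) (# S) (# (∁ S)) (# B) (i B S)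
         (sum (λ v → ⟦ S v ⟧ * deg B v)) (sum (λ v → ⟦ S v ⟧ * η v)) (m * ⟦ S u ⟧)
         partition-count (bound S ℓ) (degree-sum S)
         (sum-mono (saturation S (Obstruction.saturated obs)))
         (sum-η S) (inner S (S u) refl)
         (subst₂ (λ p q → p + m < m * q) (i-𝕍 B) (split S) (≰⇒> loose))
    where
    arith : ∀ x c iU s U β iS D N t →
      m * U + x ≤ iU + c → c ≤ x + s + m → iU + D ≡ β + iS → N ≤ D → N + t ≡ (2 * m + 1) * s →
      iS + t ≤ m * s → β + m < m * (s + U) → ⊥
    arith x c iU s U β iS D N t h₁ h₂ h₃ h₄ h₅ h₆ h₇ = <-irrefl (refl {x = 0}) (≤-from 0
      (+-mono-≤ h₁ (+-mono-≤ h₂ (+-mono-≤ (≤-reflexive h₃) (+-mono-≤ h₄ (+-mono-≤ (≤-reflexive (sym h₅)) (+-mono-≤ h₆ h₇))))))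
      (solve (m ∷ x ∷ c ∷ iU ∷ s ∷ U ∷ β ∷ iS ∷ D ∷ N ∷ t ∷ [])))

    split : ∀ (S : Sub (order G)) → # 𝕍 ≡ # S + # (∁ S)
    split S = trans (#-split 𝕍 S) (cong₂ _+_ (#-cong λ v → ∧-identityʳ (S v)) (#-cong λ v → ∧-identityʳ (not (S v))))

    saturation : ∀ (S : Sub (order G)) → (∀ v → S v ≡ true → η v ≤ deg B v) → ∀ v → ⟦ S v ⟧ * η v ≤ ⟦ S v ⟧ * deg B v
    saturation S h v with S v in Sv
    ... | false = z≤n
    ... | true  = +-monoˡ-≤ 0 (h v Sv)

    degree-sum : ∀ (S : Sub (order G)) → i B (∁ S) + sum (λ v → ⟦ S v ⟧ * deg B v) ≡ # B + i B S
    degree-sum S = trans (cong (i B (∁ S) +_) (handshake S B))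
      (trans (sym (sum-+ (⟦_⟧ ∘ (B ∩ inside (∁ S))) _))
        (trans (sum-cong λ e → lem (B e) (S (a e)) (S (b e))) (sum-+ (⟦_⟧ ∘ B) _)))
      where
      lem : ∀ c p q → ⟦ c ∧ not p ∧ not q ⟧ + ⟦ c ⟧ * (⟦ p ⟧ + ⟦ q ⟧) ≡ ⟦ c ⟧ + ⟦ c ∧ p ∧ q ⟧
      lem = toWitness {a? = ∀ᵇ λ _ → ∀ᵇ λ _ → ∀ᵇ λ _ → _ ≟ℕ _} _

    inner : ∀ (S : Sub (order G)) c → S u ≡ c → i B S + m * ⟦ c ⟧ ≤ m * # S
    -- The slack `m` in the sparsity of `S` pays for the degree bound at `u`, which is lower by `m`.
    inner S true  Su = subst (λ s → i B S + s ≤ m * # S) (sym (*-identityʳ m)) (Feasible.sparse B-feasible S u Su)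
    inner S false _  with 1 ≤? # S
    ... | yes p = let z , Sz = #-witness S p in ≤-trans (+-monoʳ-≤ (i B S) (≤-trans (≤-reflexive (*-zeroʳ m)) z≤n))
                    (Feasible.sparse B-feasible S z Sz)
    ... | no ¬p = ≤-trans (≤-reflexive (trans (cong (i B S +_) (*-zeroʳ m)) (trans (+-identityʳ _) (n≤0⇒n≡0
                    (≤-trans (#-mono empty) (≤-reflexive #-∅)))))) z≤n
      where
      empty : (B ∩ inside S) ⊆ (λ _ → false)
      empty e p = contradiction (#-pos {X = S} (a e) (proj₁ (∧⁻ (S (a e)) (proj₂ (∧⁻ (B e) p))))) ¬p

-- Existence of a feasible set with the full number of edges

module BaseExists (G : Graph) (m : ℕ) (η : Vertex G → ℕ) (m≥1 : 1 ≤ m) where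

  open Sparsity G
  open Crossing G
  open Incidence G
  open Rearranging G m η

  sparse? : ∀ C → Dec (Sparse m C)
  sparse? C = map′ (λ none X x Xx → ≮⇒≥ λ lt → none (X , (x , Xx) , lt))
    (λ { sp (X , (x , Xx) , lt) → <⇒≱ lt (sp X x Xx) })
    (¬? (anySub? {P = λ X → (∃[ x ] X x ≡ true) × m * # X < i C X + m}
      (λ { h ((x , Xx) , lt) → (x , trans (sym (h x)) Xx) ,
           subst₂ _<_ (cong (m *_) (#-cong h)) (cong (_+ m) (i-cong C h)) lt })
      (λ X → any? (λ x → X x ≟ᵇ true) ×-dec (_ <? _))))

  feasible? : ∀ C → Dec (Feasible C)
  feasible? C = map′ (λ (sp , d) → record { sparse = sp ; degrees = d })
    (λ fe → Feasible.sparse fe , Feasible.degrees fe) (sparse? C ×-dec all? λ v → deg C v ≤? η v)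

  feasible-cong : ∀ {C D} → C ≗ D → Feasible C → Feasible D
  feasible-cong {C} {D} h fe = record
    { sparse  = λ X x Xx → subst (λ s → s + m ≤ m * # X) (#-cong λ e → cong (_∧ inside X e) (h e)) (Feasible.sparse fe X x Xx)
    ; degrees = λ v → subst (_≤ η v) (#-cong λ e → cong (_∧ inc v e) (h e)) (Feasible.degrees fe v) }

  empty-feasible : Feasible (λ _ → false)
  empty-feasible = record
    { sparse  = λ X x Xx → subst (λ s → s + m ≤ m * # X) (sym #-∅)
        (subst (_≤ m * # X) (*-identityʳ m) (*-monoʳ-≤ m (#-pos {X = X} x Xx)))
    ; degrees = λ v → subst (_≤ η v) (sym #-∅) z≤n }

  module _ (bound : PartitionBound m) (u : Vertex G)
    (sum-η : ∀ S → sum (λ v → ⟦ S v ⟧ * η v) + m * ⟦ S u ⟧ ≡ (2 * m + 1) * # S) where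

    -- Feasibility is decidable, so a larger feasible set can be sought exhaustively. If there is
    -- none, `B` is a maximum and `¬stuck` applies.
    improve : ∀ {B} → Feasible B → ¬ Tight m B 𝕍 → ∃[ C ] (Feasible C × # B < # C)
    improve {B} fe loose with anySub? {P = λ C → Feasible C × # B < # C}
      (λ h (fe , lt) → feasible-cong h fe , subst (# B <_) (#-cong h) lt)
      (λ C → feasible? C ×-dec (_ <? _))
    ... | yes p   = p
    ... | no none = ⊥-elim (Augmenting.¬stuck G m η m≥1 B fe (λ C feC → ≮⇒≥ λ lt → none (C , feC , lt))
                      bound loose u sum-η)

    base : ∃[ B ] (Feasible B × Tight m B 𝕍)
    base = go (m * # 𝕍) (λ _ → false) empty-feasible (m≤n+m (m * # 𝕍) _)
      where
      -- `s` bounds how far `# B` is below `m * # 𝕍`; a set that reached this size would be tight on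
      -- `𝕍` all the more.
      go : ∀ s B → Feasible B → m * # 𝕍 ≤ # B + s → ∃[ B ] (Feasible B × Tight m B 𝕍)
      go s B fe le with m * # 𝕍 ≤? i B 𝕍 + m
      ... | yes tight = B , fe , tight
      go zero B fe le | no loose = contradiction
        (≤-trans le (≤-trans (≤-reflexive (trans (+-identityʳ _) (sym (i-𝕍 B)))) (m≤m+n (i B 𝕍) m))) loose
      go (suc s) B fe le | no loose with C , feC , lt ← improve fe loose =
        go s C feC (≤-trans le (≤-trans (≤-reflexive (+-suc (# B) s)) (+-monoˡ-≤ s lt)))

-- The partition bound

module Deleting (G : Graph) (m : ℕ) {k : ℕ} (ℓ : Vertex G → Fin k) where

  open Sparsity G
  open Incidence G
  open Crossing G

  private
    a b : Edge G → Vertex G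
    a = proj₁ ∘ ends G
    b = proj₂ ∘ ends G

  isolated : Sub (order G) → Sub (order G)
  isolated S v = not (S v) ∧ does (deg (inside (∁ S)) v ≟ℕ 0)

  -- The hypothesis multiplied by 2 m, with classes in place of components and twice the crossing
  -- edges added on the right. The isolated vertices are carried along because one case of the
  -- deletion is paid for by a new one.
  Bound : Sub (order G) → Set
  Bound S = 2 * m * # (image (∁ S) ℓ) + m * (m + 1) * # (isolated S) ≤ 2 * # (crossing S ℓ) + 2 * # S + 2 * m

  cdeg : Sub (order G) → Vertex G → ℕ
  cdeg S = deg (crossing S ℓ)

  crossing-outside : ∀ S {e} → crossing S ℓ e ≡ true → inside (∁ S) e ≡ true
  crossing-outside S {e} p = proj₁ (∧⁻ (inside (∁ S) e) p)

  cdeg-edge : ∀ {S v} → 1 ≤ cdeg S v → ∃[ e ] crossing S ℓ e ≡ true × inc v e ≡ true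
  cdeg-edge {S} {v} p with e , q ← #-witness (crossing S ℓ ∩ inc v) p = e , ∧⁻ (crossing S ℓ e) q

  crossed : ∀ S {v e} → crossing S ℓ e ≡ true → inc v e ≡ true → 1 ≤ cdeg S v
  crossed S {v} {e} p q = #-pos {X = crossing S ℓ ∩ inc v} e (∧⁺ p q)

  crossed⇒∉ : ∀ S {v} → 1 ≤ cdeg S v → S v ≡ false
  crossed⇒∉ S {v} p with e , cr , v-e ← cdeg-edge {S} {v} p = not-injective (inc-inside {v} {e} (∁ S) v-e (crossing-outside S cr))

  crossed⇒¬isolated : ∀ S {v} → 1 ≤ cdeg S v → isolated S v ≡ false
  crossed⇒¬isolated S {v} p = trans (cong (not (S v) ∧_) (dec-false (deg (inside (∁ S)) v ≟ℕ 0) λ eq → <-irrefl (sym eq)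
    (≤-trans p (#-mono λ e q → let cr , v-e = ∧⁻ (crossing S ℓ e) q in ∧⁺ (crossing-outside S cr) v-e)))) (∧-zeroʳ _)

  module _ (S N : Sub (order G)) (N-crossed : ∀ v → N v ≡ true → 1 ≤ cdeg S v) where

    inside-∪ : inside (∁ (S ∪ N)) ⊆ inside (∁ S)
    inside-∪ e = lem (S (a e)) (S (b e)) (N (a e)) (N (b e))
      where
      lem : ∀ p q r s → not (p ∨ r) ∧ not (q ∨ s) ≡ true → not p ∧ not q ≡ true
      lem false false _ _ _ = refl
      lem false true true  _ ()
      lem false true false _ ()

    crossing-∪ : crossing (S ∪ N) ℓ ⊆ crossing S ℓ
    crossing-∪ e p with q , r ← ∧⁻ (inside (∁ (S ∪ N)) e) p = ∧⁺ (inside-∪ e q) r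

    used-∪ : # (image (∁ S) ℓ) ≤ # (image (∁ (S ∪ N)) ℓ) + # N
    used-∪ = ≤-trans (#-mono sub) (≤-trans (≤-trans (m≤m+n _ _) (≤-reflexive (sym (#-∪∩ (image (∁ (S ∪ N)) ℓ) (image N ℓ)))))
      (+-monoʳ-≤ _ (#-image N ℓ)))
      where
      sub : image (∁ S) ℓ ⊆ (image (∁ (S ∪ N)) ℓ ∪ image N ℓ)
      sub j p with v , ¬Sv , refl ← ∈-image⁻ (∁ S) ℓ p with N v in Nv
      ... | true  = ∨⁺ʳ _ (∈-image⁺ N ℓ Nv)
      ... | false = ∨⁺ˡ _ (∈-image⁺ (∁ (S ∪ N)) ℓ (cong not (trans (cong (_∨ N v) (not-injective ¬Sv)) Nv)))

    size-∪ : # (S ∪ N) ≤ # S + # N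
    size-∪ = ≤-trans (m≤m+n _ _) (≤-reflexive (sym (#-∪∩ S N)))

    -- Vertices of `N` have crossing edges, so none of them is isolated, and deletion creates no
    -- edges.
    isolated-∪ : isolated S ⊆ isolated (S ∪ N)
    isolated-∪ v p with ¬Sv , d ← ∧⁻ (not (S v)) p = ∧⁺
      (cong not (trans (cong (_∨ N v) (not-injective ¬Sv)) (¬-not λ Nv → contradiction (trans (sym p) (crossed⇒¬isolated S (N-crossed v Nv))) λ ())))
      (dec-true (deg (inside (∁ (S ∪ N))) v ≟ℕ 0) (n≤0⇒n≡0 (≤-trans (#-mono λ e q →
        let r , v-e = ∧⁻ (inside (∁ (S ∪ N)) e) q in ∧⁺ (inside-∪ e r) v-e) (≤-reflexive (does⇒ (deg (inside (∁ S)) v ≟ℕ 0) d)))))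

    smaller-∪ : ∀ v → N v ≡ true → # (∁ (S ∪ N)) < # (∁ S)
    smaller-∪ v Nv = #-strict sub v (cong not (crossed⇒∉ S (N-crossed v Nv))) (cong not (∨⁺ʳ (S v) Nv))
      where
      sub : ∁ (S ∪ N) ⊆ ∁ S
      sub w p with S w
      ... | false = refl

    not-inside-∪ : ∀ {v e} → N v ≡ true → inc v e ≡ true → inside (∁ (S ∪ N)) e ≡ false
    not-inside-∪ {v} {e} Nv v-e = ¬-not λ p → contradiction
      (trans (sym (inc-inside {v} {e} (∁ (S ∪ N)) v-e p)) (cong not (∨⁺ʳ (S v) Nv))) λ ()

  private
    only : ∀ S {v} → 1 ≤ cdeg S v → ∀ w → ｛ v ｝ w ≡ true → 1 ≤ cdeg S w
    only S p w q = subst (λ x → 1 ≤ cdeg S x) (sym (==⇒≡ {x = w} q)) p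

  -- The class of `v` survives through `w`, so no label disappears, and at least one crossing edge
  -- is lost for the one vertex deleted.
  delete-repeated : ∀ {S v w} → 1 ≤ cdeg S v → w ≢ v → S w ≡ false → ℓ w ≡ ℓ v →
                    Bound (S +ₑ v) → Bound S
  delete-repeated {S} {v} {w} p w≢v Sw eq = arith (# (image (∁ S) ℓ)) (# (image (∁ S′) ℓ))
      (# (isolated S)) (# (isolated S′)) (# (crossing S ℓ)) (# (crossing S′ ℓ)) (# S) (# S′)
      (#-mono used-⊆) (#-mono (isolated-∪ S ｛ v ｝ (only S p)))
      (let e , cr , v-e = cdeg-edge {S} {v} p in #-strict (crossing-∪ S ｛ v ｝ (only S p)) e cr
        (cong (_∧ not (ℓ (a e) == ℓ (b e))) (not-inside-∪ S ｛ v ｝ (only S p) {v} {e} (==-refl v) v-e)))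
      (subst (λ s → # S′ ≤ # S + s) (#-point v) (size-∪ S ｛ v ｝ (only S p)))
    where
    S′ : Sub (order G)
    S′ = S +ₑ v
    arith : ∀ u u′ i i′ c c′ s s′ → u ≤ u′ → i ≤ i′ → c′ < c → s′ ≤ s + 1 →
      2 * m * u′ + m * (m + 1) * i′ ≤ 2 * c′ + 2 * s′ + 2 * m → 2 * m * u + m * (m + 1) * i ≤ 2 * c + 2 * s + 2 * m
    arith u u′ i i′ c c′ s s′ h₁ h₂ h₃ h₄ h₅ = ≤-from 0
      (+-mono-≤ (*-scale (2 * m) h₁) (+-mono-≤ (*-scale (m * (m + 1)) h₂)
        (+-mono-≤ (*-scale 2 h₃) (+-mono-≤ (*-scale 2 h₄) h₅))))
      (solve (m ∷ u ∷ u′ ∷ i ∷ i′ ∷ c ∷ c′ ∷ s ∷ s′ ∷ []))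
    outside-S′ : ∀ {x} → S x ≡ false → x ≢ v → ∁ S′ x ≡ true
    outside-S′ {x} Sx x≢v = cong not (trans (cong (_∨ (x == v)) Sx) (dec-false (x ≟ v) x≢v))
    used-⊆ : image (∁ S) ℓ ⊆ image (∁ S′) ℓ
    used-⊆ j q with x , ¬Sx , refl ← ∈-image⁻ (∁ S) ℓ q with x ≟ v
    ... | no x≢v = ∈-image⁺ (∁ S′) ℓ (outside-S′ (not-injective ¬Sx) x≢v)
    ... | yes refl = subst (λ j → image (∁ S′) ℓ j ≡ true) eq (∈-image⁺ (∁ S′) ℓ (outside-S′ Sw w≢v))

  -- Of the `m + 1` crossing edges lost, `m` pay for the label that may disappear and one for the
  -- vertex deleted.
  delete-heavy : ∀ {S v} → m + 1 ≤ cdeg S v → Bound (S +ₑ v) → Bound S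
  delete-heavy {S} {v} p = arith (# (image (∁ S) ℓ)) (# (image (∁ S′) ℓ))
      (# (isolated S)) (# (isolated S′)) (# (crossing S ℓ)) (# (crossing S′ ℓ)) (# S) (# S′) (cdeg S v)
      (subst (λ s → # (image (∁ S) ℓ) ≤ # (image (∁ S′) ℓ) + s) (#-point v) (used-∪ S ｛ v ｝ (only S p′)))
      (#-mono (isolated-∪ S ｛ v ｝ (only S p′)))
      (≤-trans (≤-reflexive (sym (sum-+ (⟦_⟧ ∘ crossing S′ ℓ) _))) (sum-mono lost)) p
      (subst (λ s → # S′ ≤ # S + s) (#-point v) (size-∪ S ｛ v ｝ (only S p′)))
    where
    p′ : 1 ≤ cdeg S v
    p′ = ≤-trans (m≤n+m 1 m) p
    S′ : Sub (order G)
    S′ = S +ₑ v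
    arith : ∀ u u′ i i′ c c′ s s′ d → u ≤ u′ + 1 → i ≤ i′ → c′ + d ≤ c → m + 1 ≤ d → s′ ≤ s + 1 →
      2 * m * u′ + m * (m + 1) * i′ ≤ 2 * c′ + 2 * s′ + 2 * m → 2 * m * u + m * (m + 1) * i ≤ 2 * c + 2 * s + 2 * m
    arith u u′ i i′ c c′ s s′ d h₁ h₂ h₃ h₄ h₅ h₆ = ≤-from 0
      (+-mono-≤ (*-scale (2 * m) h₁) (+-mono-≤ (*-scale (m * (m + 1)) h₂)
        (+-mono-≤ (*-scale 2 h₃) (+-mono-≤ (*-scale 2 h₄) (+-mono-≤ (*-scale 2 h₅) h₆)))))
      (solve (m ∷ u ∷ u′ ∷ i ∷ i′ ∷ c ∷ c′ ∷ s ∷ s′ ∷ d ∷ []))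
    lost : ∀ e → ⟦ crossing S′ ℓ e ⟧ + ⟦ crossing S ℓ e ∧ inc v e ⟧ ≤ ⟦ crossing S ℓ e ⟧
    lost e = lem (crossing S′ ℓ e) (crossing S ℓ e) (inc v e) (crossing-∪ S ｛ v ｝ (only S p′) e)
      λ v-e → cong (_∧ not (ℓ (a e) == ℓ (b e))) (not-inside-∪ S ｛ v ｝ (only S p′) {v} {e} (==-refl v) v-e)
      where
      lem : ∀ c′ c x → (c′ ≡ true → c ≡ true) → (x ≡ true → c′ ≡ false) → ⟦ c′ ⟧ + ⟦ c ∧ x ⟧ ≤ ⟦ c ⟧
      lem = toWitness {a? = ∀ᵇ λ _ → ∀ᵇ λ _ → ∀ᵇ λ _ →
        ((_ ≟ᵇ _) →-dec (_ ≟ᵇ _)) →-dec (((_ ≟ᵇ _) →-dec (_ ≟ᵇ _)) →-dec (_ ≤? _))} _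

  other : Vertex G → Edge G → Vertex G
  other v e = if v == a e then b e else a e

  other-joins : ∀ {v e} → inc v e ≡ true → Joins G e v (other v e)
  other-joins {v} {e} p with v ≟ a e
  ... | yes refl = inj₁ refl
  ... | no _     = inj₂ (cong (a e ,_) (sym (==⇒≡ p)))

  joins-≢ : ∀ {e x y} → Joins G e x y → x ≢ y
  joins-≢ {e} (inj₁ refl) = loopless G e
  joins-≢ {e} (inj₂ refl) = ≢-sym (loopless G e)

  joins-inc : ∀ {e x y} → Joins G e x y → inc y e ≡ true
  joins-inc {y = y} (inj₁ refl) = ∨⁺ʳ _ (==-refl y)
  joins-inc {y = y} (inj₂ refl) = ∨⁺ˡ _ (==-refl y)

  -- Deleting the crossing neighbours of v isolates v when v has a label of its own.
  module Isolating {S : Sub (order G)} {v : Vertex G} (p : 1 ≤ cdeg S v)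
    (alone : ∀ w → S w ≡ false → ℓ w ≡ ℓ v → w ≡ v)
    (light : cdeg S v ≤ m) (least : ∀ w → 1 ≤ cdeg S w → cdeg S v ≤ cdeg S w) where

    N : Sub (order G)
    N = image (crossing S ℓ ∩ inc v) (other v)

    S′ : Sub (order G)
    S′ = S ∪ N

    N-edge : ∀ {w} → N w ≡ true → ∃[ e ] crossing S ℓ e ≡ true × Joins G e v w
    N-edge q with e , r , refl ← ∈-image⁻ (crossing S ℓ ∩ inc v) (other v) q with cr , v-e ← ∧⁻ (crossing S ℓ e) r =
      e , cr , other-joins {v} {e} v-e

    N-crossed : ∀ w → N w ≡ true → 1 ≤ cdeg S w
    N-crossed w q with e , cr , j ← N-edge q = crossed S {w} {e} cr (joins-inc {e} j)

    v∉N : N v ≡ false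
    v∉N = ¬-not λ q → let e , cr , j = N-edge q in joins-≢ {e} j refl

    neighbour : ∀ {e} → crossing S ℓ e ≡ true → inc v e ≡ true → N (other v e) ≡ true
    neighbour cr v-e = ∈-image⁺ (crossing S ℓ ∩ inc v) (other v) (∧⁺ cr v-e)

    some-neighbour : ∃[ w ] N w ≡ true
    some-neighbour with e , cr , v-e ← cdeg-edge {S} {v} p = other v e , neighbour {e} cr v-e

    -- No other vertex outside `S` has the label of `v`, so every edge at `v` that avoids `S`
    -- crosses.
    inside⇒crossing : ∀ {e} → inside (∁ S) e ≡ true → inc v e ≡ true → crossing S ℓ e ≡ true
    inside⇒crossing {e} q v-e = ∧⁺ q (cong not (dec-false (ℓ (a e) ≟ ℓ (b e)) λ eq → different (other-joins {v} {e} v-e) eq))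
      where
      different : ∀ {w} → Joins G e v w → ℓ (a e) ≢ ℓ (b e)
      different (inj₁ refl) eq = loopless G e (sym (alone _ (not-injective (proj₂ (∧⁻ (not (S (a e))) q))) (sym eq)))
      different (inj₂ refl) eq = loopless G e (alone _ (not-injective (proj₁ (∧⁻ (not (S (a e))) q))) eq)

    v-lost : ∀ {e} → inc v e ≡ true → inside (∁ S′) e ≡ false
    v-lost {e} v-e = ¬-not λ q → let q′ = inside-∪ S N N-crossed e q in contradiction
      (trans (sym (not-inside-∪ S N N-crossed {other v e} {e} (neighbour {e} (inside⇒crossing q′ v-e) v-e)
        (joins-inc {e} (other-joins {v} {e} v-e)))) q) λ ()

    v-isolated : isolated S′ v ≡ true
    v-isolated = ∧⁺ (cong not (trans (cong (_∨ N v) (crossed⇒∉ S p)) v∉N)) (dec-true (deg (inside (∁ S′)) v ≟ℕ 0)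
      (trans (#-cong empty) #-∅))
      where
      empty : ∀ e → (inside (∁ S′) ∩ inc v) e ≡ false
      empty e = ¬-not λ q → let in′ , v-e = ∧⁻ (inside (∁ S′) e) q in
        contradiction (trans (sym (v-lost {e} v-e)) in′) λ ()

    A : Sub (order G)
    A = N +ₑ v

    -- All crossing edges with an end in `A` disappear, and the degree sum counts each at most
    -- twice.
    lost : 2 * # (crossing S′ ℓ) + sum (λ w → ⟦ A w ⟧ * cdeg S w) ≤ 2 * # (crossing S ℓ)
    lost = ≤-trans (≤-reflexive (trans (cong₂ _+_ (sym (sum-* 2 (⟦_⟧ ∘ crossing S′ ℓ))) (handshake A (crossing S ℓ)))
        (sym (sum-+ (λ e → 2 * ⟦ crossing S′ ℓ e ⟧) _))))
      (≤-trans (sum-mono pt) (≤-reflexive (sum-* 2 (⟦_⟧ ∘ crossing S ℓ))))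
      where
      lem : ∀ c′ c p q → (c′ ≡ true → c ≡ true) → (c′ ≡ true → p ≡ false) → (c′ ≡ true → q ≡ false) →
            2 * ⟦ c′ ⟧ + ⟦ c ⟧ * (⟦ p ⟧ + ⟦ q ⟧) ≤ 2 * ⟦ c ⟧
      lem = toWitness {a? = ∀ᵇ λ _ → ∀ᵇ λ _ → ∀ᵇ λ _ → ∀ᵇ λ _ →
        ((_ ≟ᵇ _) →-dec (_ ≟ᵇ _)) →-dec (((_ ≟ᵇ _) →-dec (_ ≟ᵇ _)) →-dec (((_ ≟ᵇ _) →-dec (_ ≟ᵇ _)) →-dec (_ ≤? _)))} _
      gone : ∀ {w e} → A w ≡ true → inc w e ≡ true → inside (∁ S′) e ≡ false
      gone {w} {e} Aw w-e with ∨⁻ (N w) Aw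
      ... | inj₁ Nw = not-inside-∪ S N N-crossed {w} {e} Nw w-e
      ... | inj₂ q = v-lost {e} (subst (λ x → inc x e ≡ true) (==⇒≡ {x = w} q) w-e)
      free : ∀ {w e} → inc w e ≡ true → crossing S′ ℓ e ≡ true → A w ≡ false
      free {w} {e} w-e cr = ¬-not λ Aw → contradiction (trans (sym (gone {w} {e} Aw w-e)) (crossing-outside S′ cr)) λ ()
      pt : ∀ e → 2 * ⟦ crossing S′ ℓ e ⟧ + ⟦ crossing S ℓ e ⟧ * (⟦ A (a e) ⟧ + ⟦ A (b e) ⟧) ≤ 2 * ⟦ crossing S ℓ e ⟧
      pt e = lem (crossing S′ ℓ e) (crossing S ℓ e) (A (a e)) (A (b e)) (crossing-∪ S N N-crossed e)
        (free {a e} {e} (∨⁺ˡ (a e == b e) (==-refl (a e)))) (free {b e} {e} (∨⁺ʳ (b e == a e) (==-refl (b e))))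

    -- By `least`, no vertex of `A` has fewer crossing edges than `v`.
    A-degrees : (# N + 1) * cdeg S v ≤ sum (λ w → ⟦ A w ⟧ * cdeg S w)
    A-degrees = ≤-trans (≤-reflexive (trans (*-comm (# N + 1) _) (trans (cong (cdeg S v *_) (sym #A))
        (sym (sum-* (cdeg S v) (⟦_⟧ ∘ A)))))) (sum-mono pt)
      where
      #A : # A ≡ # N + 1
      #A = #-add N v∉N
      pt : ∀ w → cdeg S v * ⟦ A w ⟧ ≤ ⟦ A w ⟧ * cdeg S w
      pt w with A w in Aw
      ... | false = ≤-reflexive (*-zeroʳ (cdeg S v))
      ... | true = ≤-trans (≤-reflexive (*-identityʳ _)) (≤-trans (least w (cases (∨⁻ (N w) Aw))) (≤-reflexive (sym (*-identityˡ _))))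
        where
        cases : N w ≡ true ⊎ (w == v) ≡ true → 1 ≤ cdeg S w
        cases (inj₁ q) = N-crossed w q
        cases (inj₂ q) = only S p w q

    delete-neighbours : Bound S′ → Bound S
    delete-neighbours = arith m (# (image (∁ S) ℓ)) (# (image (∁ S′) ℓ)) (# (isolated S)) (# (isolated S′))
      (# (crossing S ℓ)) (# (crossing S′ ℓ)) (# S) (# S′) (# N) (cdeg S v) (sum (λ w → ⟦ A w ⟧ * cdeg S w))
      (used-∪ S N N-crossed)
      (#-strict (isolated-∪ S N N-crossed) v v-isolated (crossed⇒¬isolated S p))
      lost A-degrees (size-∪ S N N-crossed) (#-image (crossing S ℓ ∩ inc v) (other v)) light
      where
      -- For K ≤ d ≤ m the gain is at least m (m + 1) + (K + 1) d - 2 K (m + 1) ≥ (m - K) (m - K + 1).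
      arith : ∀ m u u′ i i′ c c′ s s′ K d t → u ≤ u′ + K → i < i′ → 2 * c′ + t ≤ 2 * c → (K + 1) * d ≤ t → s′ ≤ s + K →
        K ≤ d → d ≤ m →
        2 * m * u′ + m * (m + 1) * i′ ≤ 2 * c′ + 2 * s′ + 2 * m → 2 * m * u + m * (m + 1) * i ≤ 2 * c + 2 * s + 2 * m
      arith m u u′ i i′ c c′ s s′ K d t h₁ h₂ h₃ h₄ h₅ K≤d d≤m h₆
        with m≤n⇒∃[o]m+o≡n K≤d | m≤n⇒∃[o]m+o≡n d≤m
      ... | p , refl | q , refl = ≤-from ((p + q) * (p + q) + (p + q) + (K + 1) * p)
          (+-mono-≤ (*-scale (2 * (K + p + q)) h₁) (+-mono-≤ (*-scale ((K + p + q) * (K + p + q + 1)) h₂)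
            (+-mono-≤ h₃ (+-mono-≤ h₄ (+-mono-≤ (*-scale 2 h₅) h₆)))))
          (solve (u ∷ u′ ∷ i ∷ i′ ∷ c ∷ c′ ∷ s ∷ s′ ∷ K ∷ p ∷ q ∷ t ∷ []))

  module _ (base : ∀ S → (∀ v → ¬ 1 ≤ cdeg S v) → Bound S) where

    bound : ∀ S → Bound S
    bound S = go (# 𝕍) S (#-mono λ _ _ → refl)
      where
      go : ∀ s S → # (∁ S) ≤ s → Bound S
      descend : ∀ s {S} → # (∁ S) ≤ s → ∀ S′ → # (∁ S′) < # (∁ S) → Bound S′
      descend zero    le S′ lt = contradiction (≤-trans lt le) λ ()
      descend (suc s) le S′ lt = go s S′ (≤-pred (≤-trans lt le))
      go s S le with any? (λ v → 1 ≤? cdeg S v)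
      ... | no none = base S λ v p → none (v , p)
      ... | yes (v₀ , p₀) with any? (λ v → any? λ w → (1 ≤? cdeg S v) ×-dec ¬? (w ≟ v) ×-dec (S w ≟ᵇ false) ×-dec (ℓ w ≟ ℓ v))
      ...   | yes (v , w , p , w≢v , Sw , eq) =
                delete-repeated p w≢v Sw eq (descend s {S} le (S +ₑ v) (smaller-∪ S ｛ v ｝ (only S p) v (==-refl v)))
      ...   | no alone with any? (λ v → m + 1 ≤? cdeg S v)
      ...     | yes (v , p) = delete-heavy p (descend s {S} le (S +ₑ v)
                (smaller-∪ S ｛ v ｝ (only S (≤-trans (m≤n+m 1 m) p)) v (==-refl v)))
      -- `Bound S` is a decidable inequality, so a vertex with the least positive number of crossing
      -- edges may be chosen under double negation.
      ...     | no light = decidable-stable (_ ≤? _) λ κ →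
                ¬¬-minimal {A = Σ[ v ∈ Vertex G ] 1 ≤ cdeg S v} (cdeg S ∘ proj₁) (v₀ , p₀) λ ((v , p) , least) →
                let module I = Isolating {S} {v} p
                      (λ w Sw eq → decidable-stable (w ≟ v) λ w≢v → alone (v , w , p , w≢v , Sw , eq))
                      (≤-pred (subst (cdeg S v <_) (+-comm m 1) (≰⇒> λ q → light (v , q))))
                      (λ w q → least (w , q))
                in κ (I.delete-neighbours (descend s {S} le I.S′
                  (smaller-∪ S I.N I.N-crossed (proj₁ I.some-neighbour) (proj₂ I.some-neighbour))))

-- Applying the hypothesis when no edge crosses

∣tabulate∣ : (X : Sub n) → ∣ tabulate X ∣ ≡ # X
∣tabulate∣ {zero}  X = sym (sum-empty (⟦_⟧ ∘ X))
∣tabulate∣ {suc n} X = trans head (sym (sum-suc (⟦_⟧ ∘ X)))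
  where
  head : ∣ tabulate X ∣ ≡ ⟦ X zero ⟧ + # (X ∘ suc)
  head with X zero
  ... | true  = cong suc (∣tabulate∣ (X ∘ suc))
  ... | false = ∣tabulate∣ (X ∘ suc)

module Hypothesis (G : Graph) (m : ℕ) .{{_ : NonZero m}}
  (tough : ∀ (S : Subset (order G)) → m * (m + 1) * iso (G ∖ S) + 2 * m * ω (G ∖ S) ≤ 2 * ∣ S ∣ + 2 * m) where

  open Sparsity G
  open Incidence G
  open Crossing G

  module _ (S : Sub (order G)) where

    H : Subgraph G
    H = G ∖ tabulate S

    ∉⇒vertex : ∀ {v} → S v ≡ false → v Subset.∈ vertices H
    ∉⇒vertex {v} Sv = x∉p⇒x∈∁p λ v∈ → contradiction (trans (sym ([]=⇒lookup v∈)) (trans (lookup∘tabulate S v) Sv)) λ ()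

    vertex⇒∉ : ∀ {v} → v Subset.∈ vertices H → S v ≡ false
    vertex⇒∉ {v} v∈ = ¬-not λ Sv → x∈∁p⇒x∉p v∈ (lookup⇒[]= v _ (trans (lookup∘tabulate S v) Sv))

    edge⇒inside : ∀ {e} → e Subset.∈ edges H → inside (∁ S) e ≡ true
    edge⇒inside e∈ = ∧⁺ (cong not (vertex⇒∉ (closed H e∈ (inj₁ refl)))) (cong not (vertex⇒∉ (closed H e∈ (inj₂ refl))))

    degree≤ : ∀ v → degree H v ≤ deg (inside (∁ S)) v
    degree≤ v = ≤-trans (≤-reflexive (∣tabulate∣ λ e → does ((e ∈? edges H) ×-dec incident? G v e))) (#-mono λ e p →
      let e∈ , v-e = ∧⁻ (does (e ∈? edges H)) p in ∧⁺ (edge⇒inside (does⇒ (e ∈? edges H) e∈)) v-e)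

    module _ {k : ℕ} (ℓ : Vertex G → Fin k) where

      open Deleting G m ℓ

      isolated≤iso : # (isolated S) ≤ iso H
      isolated≤iso = ≤-trans (#-mono sub) (≤-reflexive (sym (∣tabulate∣ λ v → does ((v ∈? vertices H) ×-dec (degree H v ≟ℕ 0)))))
        where
        sub : isolated S ⊆ (λ v → does ((v ∈? vertices H) ×-dec (degree H v ≟ℕ 0)))
        sub v p with ¬Sv , d ← ∧⁻ (not (S v)) p = dec-true ((v ∈? vertices H) ×-dec (degree H v ≟ℕ 0))
          (∉⇒vertex (not-injective ¬Sv) , n≤0⇒n≡0 (≤-trans (degree≤ v) (≤-reflexive (does⇒ (deg (inside (∁ S)) v ≟ℕ 0) d))))

      module _ (uncrossed : ∀ v → ¬ 1 ≤ cdeg S v) where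

        edge-label : ∀ {e} → e Subset.∈ edges H → ℓ (proj₁ (ends G e)) ≡ ℓ (proj₂ (ends G e))
        edge-label {e} e∈ = decidable-stable (_ ≟ _) λ ℓ≢ → uncrossed (proj₁ (ends G e))
          (crossed S {proj₁ (ends G e)} {e} (∧⁺ (edge⇒inside e∈) (cong not (dec-false (_ ≟ _) ℓ≢)))
            (∨⁺ˡ _ (==-refl (proj₁ (ends G e)))))

        walk-label : ∀ {v w} → Walk H v w → ℓ v ≡ ℓ w
        walk-label stop = refl
        walk-label (step e e∈ (inj₁ refl) p) = trans (edge-label e∈) (walk-label p)
        walk-label (step e e∈ (inj₂ refl) p) = trans (sym (edge-label e∈)) (walk-label p)

        -- Labels are constant along walks, so each label in use is carried by one of the
        -- representatives that `ω` counts.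
        labels≤ω : # (image (∁ S) ℓ) ≤ ω H
        labels≤ω = ≤-trans (#≤length (image (∁ S) ℓ) (List.map ℓ reps) represented) (≤-reflexive (length-map ℓ reps))
          where
          reps : List (Vertex G)
          reps = deduplicate (walk? H) (filter (_∈? vertices H) (allFin (order G)))
          represented : ∀ j → image (∁ S) ℓ j ≡ true → j ∈ˡ List.map ℓ reps
          represented j p with v , ¬Sv , refl ← ∈-image⁻ (∁ S) ℓ p =
            Any.map⁺ (Any.deduplicate⁺ (walk? H) (λ q eq → trans eq (sym (walk-label q)))
              (Any.map (cong ℓ) (∈-filter⁺ (_∈? vertices H) (∈-allFin v) (∉⇒vertex (not-injective ¬Sv)))))

        uncrossed-bound : Bound S
        uncrossed-bound = ≤-trans (≤-trans (≤-trans (+-mono-≤ (*-scale (2 * m) labels≤ω) (*-scale (m * (m + 1)) isolated≤iso))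
          (≤-reflexive (+-comm (2 * m * ω H) _)))
          (subst (λ s → m * (m + 1) * iso H + 2 * m * ω H ≤ 2 * s + 2 * m) (∣tabulate∣ S) (tough (tabulate S))))
          (+-monoˡ-≤ (2 * m) (m≤n+m (2 * # S) (2 * # (crossing S ℓ))))

  partition-bound : PartitionBound m
  partition-bound S ℓ = *-cancelˡ-≤ 2 (arith (# (image (∁ S) ℓ)) (# (isolated S)) (# (crossing S ℓ)) (# S)
      (bound (λ S → uncrossed-bound S ℓ) S))
    where
    open Deleting G m ℓ
    arith : ∀ u i c s → 2 * m * u + m * (m + 1) * i ≤ 2 * c + 2 * s + 2 * m → 2 * (m * u) ≤ 2 * (c + s + m)
    -- The slack is the contribution of the isolated vertices, dropped at this point.
    arith u i c s h = ≤-from (m * (m + 1) * i) h (solve (m ∷ u ∷ i ∷ c ∷ s ∷ []))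

-- The hypothesis over ℚ

open import Data.Integer as ℤ using (+_)
open import Data.Integer.Properties using (drop‿+≤+; pos-*)
import Data.Rational.Unnormalised as ℚ
open import Data.Rational.Unnormalised using (_/_; 1ℚᵘ)

-- Comparison of unnormalised rationals is cross-multiplication over ℤ. `left` and `right` exhibit
-- its two sides as images of naturals; the outcome is the hypothesis multiplied by twice `suc k`.
clear-denominators : ∀ k i w s →
  (+ (suc k + 1) / 2) ℚ.* (+ i / 1) ℚ.+ (+ w / 1) ℚ.≤ (+ 1 / suc k) ℚ.* (+ s / 1) ℚ.+ 1ℚᵘ →
  suc k * (suc k + 1) * i + 2 * suc k * w ≤ 2 * s + 2 * suc k
clear-denominators k i w s (ℚ.*≤* h) = ≤-from 0 (drop‿+≤+ (subst₂ ℤ._≤_ left right h))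
    (solve (k ∷ i ∷ w ∷ s ∷ []))
  where
  left : ((+ (suc k + 1) ℤ.* + i) ℤ.* + 1 ℤ.+ + w ℤ.* + 2) ℤ.* + (suc k * 1 * 1) ≡ + (((suc k + 1) * i * 1 + w * 2) * (suc k * 1 * 1))
  left rewrite sym (pos-* (suc k + 1) i) | sym (pos-* ((suc k + 1) * i) 1) | sym (pos-* w 2) =
    sym (pos-* ((suc k + 1) * i * 1 + w * 2) (suc k * 1 * 1))
  right : ((+ 1 ℤ.* + s) ℤ.* + 1 ℤ.+ + 1 ℤ.* + (suc k * 1)) ℤ.* + 2 ≡ + ((1 * s * 1 + 1 * (suc k * 1)) * 2)
  right rewrite sym (pos-* 1 s) | sym (pos-* (1 * s) 1) | sym (pos-* 1 (suc k * 1)) =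
    sym (pos-* (1 * s * 1 + 1 * (suc k * 1)) 2)

mainTheorem15 : (m : ℕ) .{{_ : NonZero m}} (G : Graph) →
    (∀ (S : Subset (order G)) →
    (+ (m + 1) / 2) ℚ.* (+ iso (G ∖ S) / 1) ℚ.+ (+ ω (G ∖ S) / 1)
    ℚ.≤ (+ 1 / m) ℚ.* (+ ∣ S ∣ / 1) ℚ.+ 1ℚᵘ) →
    ∀ (u : Vertex G) →
    Σ[ H ∈ Subgraph G ]
    (Spanning H × TreeConnected m H ×
    (∀ v → degree H v ≤ 2 * m + 1) ×
    degree H u ≤ m + 1)
mainTheorem15 zero {{()}}
mainTheorem15 m@(suc k) G hyp u = asSubgraph B , spanning , treeConnected m B u (Feasible.sparse feasible) tight ,
    (λ v → ≤-trans (degree≤ v) (η≤ v)) ,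
    ≤-trans (degree≤ u) (≤-reflexive (cong (λ c → if c then m + 1 else 2 * m + 1) (==-refl u)))
  where
  η : Vertex G → ℕ
  η v = if v == u then m + 1 else 2 * m + 1

  η≤ : ∀ v → η v ≤ 2 * m + 1
  η≤ v with v == u
  ... | true  = +-monoˡ-≤ 1 (m≤m+n m (m + 0))
  ... | false = ≤-refl

  open Sparsity G
  open Incidence G
  open Rearranging G m η

  -- `η` is the constant `2 * m + 1` lowered by `m` at `u`.
  sum-η : ∀ S → sum (λ v → ⟦ S v ⟧ * η v) + m * ⟦ S u ⟧ ≡ (2 * m + 1) * # S
  sum-η S = sym (trans (sym (sum-* (2 * m + 1) (⟦_⟧ ∘ S))) (trans (sum-cong λ v → pt v (S v))
    (trans (sum-+ (λ v → ⟦ S v ⟧ * η v) (λ v → ⟦ v == u ⟧ * (m * ⟦ S v ⟧)))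
      (cong (_+_ (sum (λ v → ⟦ S v ⟧ * η v))) (sum-point u (λ v → m * ⟦ S v ⟧))))))
    where
    full : ∀ m → (2 * m + 1) * 1 ≡ 1 * (m + 1) + 1 * (m * 1)
    full = solve-∀
    rest : ∀ m → (2 * m + 1) * 1 ≡ 1 * (2 * m + 1) + 0
    rest = solve-∀
    none : ∀ m c → (2 * m + 1) * 0 ≡ c * (m * 0)
    none = solve-∀
    pt : ∀ v c → (2 * m + 1) * ⟦ c ⟧ ≡ ⟦ c ⟧ * η v + ⟦ v == u ⟧ * (m * ⟦ c ⟧)
    pt v false = none m ⟦ v == u ⟧
    pt v true with v == u
    ... | true  = full m
    ... | false = rest m

  result : Σ[ B ∈ Sub (size G) ] (Feasible B × Tight m B 𝕍)
  result = BaseExists.base G m η (s≤s z≤n)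
    (Hypothesis.partition-bound G m λ S → clear-denominators k (iso (G ∖ S)) (ω (G ∖ S)) ∣ S ∣ (hyp S)) u sum-η

  B : Sub (size G)
  B = proj₁ result

  feasible : Feasible B
  feasible = proj₁ (proj₂ result)

  tight : Tight m B 𝕍
  tight = proj₂ (proj₂ result)

  spanning : Spanning (asSubgraph B)
  spanning v = lookup⇒[]= v _ (lookup∘tabulate 𝕍 v)

  degree≤ : ∀ v → degree (asSubgraph B) v ≤ η v
  degree≤ v = ≤-trans (≤-trans (≤-reflexive (∣tabulate∣ λ e → does ((e ∈? edges (asSubgraph B)) ×-dec incident? G v e)))
    (#-mono λ e p → let e∈ , v-e = ∧⁻ (does (e ∈? edges (asSubgraph B))) p in
      ∧⁺ (∈-edges⁻ (does⇒ (e ∈? edges (asSubgraph B)) e∈)) v-e)) (Feasible.degrees feasible v)
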